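{- Let $T$ be a trajectory string and $T_{bwt}$ its Burrows--Wheeler transform. Let $\phi^*$ be the relative movement labeling (RML) function based on the bigram ordering strategy, and let $\phi$ be any RML function for $T$. Then $$H_0(\phi^*(T_{bwt}))\le H_0(\phi(T_{bwt})).$$
   Context: Trajectory string: a network-constrained trajectory (NCT) on a directed graph $(V,E)$ is a (nonempty) sequence $e_1e_2\cdots e_n$ of physically connected road segments $e_i\in E$ (the end vertex of $e_i$ is the start vertex of $e_{i+1}$). Given NCTs $T_1,\dots,T_N$, the trajectory string is $T=T_1^r\,\$\,T_2^r\,\$\cdots T_N^r\,\$\,\#$, where $T_k^r$ is the reversal of $T_k$ and $\$,\#$ are special symbols not in $E$. The alphabet is $\Sigma=E\cup\{\$,\#\}$, $\sigma=|\Sigma|$, totally ordered with $\#<\$<w$ for all $w\in E$ (any total order on $E$). BWT: $T_{bwt}$ is the last column of the list of all $|T|$ cyclic rotations of $T$ sorted lexicographically (positions are 0-based). $C[w]$ is the number of symbols (with multiplicity) in $T$ strictly smaller than $w$; $w+1$ denotes the successor of $w$ in $\Sigma$, so $C[w+1]$ is the number of symbols of $T$ that are $\le w$. The sorted rotations starting with $w$ are exactly those at positions in $[C[w],C[w+1])$. ET-graph: directed graph with vertex set $\Sigma$ and edge set $E_T$, where $(w',w)\in E_T$ iff $ww'$ occurs as a substring of $T$, with $T$ read cyclically. $N_{out}(w')=\{w:(w',w)\in E_T\}$. RML function: an assignment of labels $\phi(w|w')\in\{1,\dots,\sigma\}$ for each $w'\in\Sigma$ and $w\in N_{out}(w')$,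 such that for each $w'$ the map $\phi(\cdot|w')$ is one-to-one on $N_{out}(w')$. Labeled BWT: $\phi(T_{bwt})$ is the string of length $|T|$ whose $i$-th symbol is $\phi(T_{bwt}[i]\,|\,w')$, where $w'$ is the unique symbol with $C[w']\le i<C[w'+1]$. Bigram ordering strategy: let $n_{ww'}$ be the number of (cyclic) occurrences of $ww'$ in $T$. For each $w'$, the elements of $N_{out}(w')$ are sorted in descending order of $n_{ww'}$ (ties broken arbitrarily), and the $i$-th element $w$ in this order receives the label $\phi^*(w|w')=i$. Entropy: for a string $S$ of length $n$, $H_0(S)=\sum_{x}\frac{n_x}{n}\lg\frac{n}{n_x}$, the sum being over symbols $x$ occurring in $S$, with $n_x$ the number of occurrences of $x$ in $S$, and $\lg=\log_2$. -}

module Defs where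

open import Data.Fin.Base using (Fin; toℕ; cast)
open import Data.Fin.Properties using (toℕ<n)
import Data.Integer.Base as ℤ
import Data.Integer.Properties as ℤ
import Data.Integer.Solver as ℤ-Solver
open import Data.List.Base as List
  using (List; []; _∷_; _++_; length; filter; foldr; lookup; tabulate; zip; deduplicate; concatMap; iterate)
open import Data.List.Membership.Propositional using (_∈_; mapWith∈)
open import Data.List.Membership.Propositional.Properties using (∈-deduplicate⁻)
open import Data.List.NonEmpty.Base as List⁺ using (List⁺; _∷_; toList; _∷ʳ_)
open import Data.List.Properties
  using (length-map; length-iterate; length-filter; filter-accept; filter-reject; filter-some)
open import Data.List.Relation.Binary.Lex.Strict using (≤-decTotalOrder)
open import Data.List.Relation.Binary.Permutation.Propositional.Properties using (↭-length)
open import Data.List.Relation.Unary.AllPairs using (AllPairs)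
open import Data.List.Relation.Unary.Linked using (Linked)
open import Data.List.Relation.Unary.Unique.Propositional using (Unique)
open import Data.List.Sort using (sort; sort-↭)
open import Data.Nat.Base as ℕ using (ℕ; zero; suc; _^_; NonZero; z≤n; s≤s)
open import Data.Nat.DivMod using (m/n*n≤m; m≥n⇒m/n>0; m≡m%n+[m/n]*n; m%n<n)
open import Data.Nat.Induction using (<-rec)
open import Data.Nat.Logarithm
  using (⌊log₂_⌋; ⌊log₂⌋-mono-≤; ⌊log₂⌊n/2⌋⌋≡⌊log₂n⌋∸1; ⌊log₂[2^n]⌋≡n)
import Data.Nat.Properties as ℕ
import Data.Nat.Solver as ℕ-Solver
import Data.Nat.Solver as ℕ-Solver
open import Data.Product using (∃; ∃!; _×_; _,_; proj₁; proj₂)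
open import Data.Product.Properties using () renaming (≡-dec to ×-≡-dec)
import Data.Rational.Unnormalised.Base as ℚ
open ℚ using (ℚᵘ; mkℚᵘ; 0ℚᵘ; 1ℚᵘ; ↥_; ↧ₙ_)
import Data.Rational.Unnormalised.Properties as ℚ
import Data.Rational.Unnormalised.Solver as ℚ-Solver
open import Data.Sum.Base using (_⊎_; inj₁; inj₂)
open import Function.Base using (_∘_)
open import Function.Bundles using (_↔_; _⇔_)
open import Level using (0ℓ)
open import Relation.Binary.Bundles using (StrictTotalOrder; DecTotalOrder)
open import Relation.Binary.Core using (Rel)
import Relation.Binary.Construct.On as On
open import Relation.Binary.Definitions
  using (DecidableEquality; Transitive; Trichotomous; tri<; tri≈; tri>)
open import Relation.Binary.PropositionalEquality
  using (_≡_; refl; sym; trans; cong; cong₂; subst; subst₂; isEquivalence; module ≡-Reasoning)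
open import Relation.Binary.Structures using (IsStrictTotalOrder)
open import Relation.Binary.Structures.Biased using (isStrictTotalOrderᶜ)
open import Relation.Nullary using (Dec; yes; no; contradiction)
open import Relation.Nullary.Decidable using (_⊎-dec_; recompute)

-- Real numbers, as Bishop's regular sequences of rationals:
-- |xₘ - xₙ| ≤ 1/(m+1) + 1/(n+1), so that xₙ is within 1/(n+1) of the limit and
-- x ≤ y iff xₙ ≤ yₙ + 2/(n+1) for all n.

1/1+_ : ℕ → ℚᵘ
1/1+ n = ℤ.+ 1 ℚ./ suc n

record ℝ : Set where
  constructor mkℝ
  field
    seq     : ℕ → ℚᵘ
    regular : ∀ m n → ℚ.∣ seq m ℚ.- seq n ∣ ℚ.≤ 1/1+ m ℚ.+ 1/1+ n

open ℝ public

infix 4 _≤ℝ_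

_≤ℝ_ : Rel ℝ 0ℓ
x ≤ℝ y = ∀ n → seq x n ℚ.≤ seq y n ℚ.+ ℤ.+ 2 ℚ./ suc n

1/1+-nonNeg : ∀ n → 0ℚᵘ ℚ.≤ 1/1+ n
1/1+-nonNeg n = ℚ.nonNegative⁻¹ (1/1+ n)

0ℝ : ℝ
0ℝ = mkℝ (λ _ → 0ℚᵘ) λ m n → ℚ.+-mono-≤ (1/1+-nonNeg m) (1/1+-nonNeg n)

1/1+-half : ∀ n → 1/1+ suc (n ℕ.+ n) ℚ.+ 1/1+ suc (n ℕ.+ n) ℚ.≃ 1/1+ n
1/1+-half n = ℚ.*≡* (cong ℤ.+_ (solve 1 (λ n →
  let s = con 2 :+ (n :+ n) in
  (con 1 :* s :+ con 1 :* s) :* (con 1 :+ n) := con 1 :* (s :* s)) refl n))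
  where open ℕ-Solver.+-*-Solver

1/1+-scale : ∀ k n → (ℤ.+ suc k ℚ./ 1) ℚ.* 1/1+ (n ℕ.+ k ℕ.* suc n) ℚ.≃ 1/1+ n
1/1+-scale k n = ℚ.*≡* (cong ℤ.+_ (solve 2 (λ k n →
  ((con 1 :+ k) :* con 1) :* (con 1 :+ n) :=
  con 1 :* (con 1 :* (con 1 :+ (n :+ k :* (con 1 :+ n))))) refl k n))
  where open ℕ-Solver.+-*-Solver

-- The sum (and, below, the rational multiple) reads its arguments further along so
-- that the errors still add up to at most 1/(n+1).
infixl 6 _+ℝ_

_+ℝ_ : ℝ → ℝ → ℝ
seq     (x +ℝ y) n   = seq x (suc (n ℕ.+ n)) ℚ.+ seq y (suc (n ℕ.+ n))
regular (x +ℝ y) m n = begin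
  ℚ.∣ (a ℚ.+ b) ℚ.- (c ℚ.+ d) ∣
    ≃⟨ ℚ.∣-∣-cong (solve 4 (λ a b c d →
         (a :+ b) :- (c :+ d) := (a :- c) :+ (b :- d)) ℚ.≃-refl a b c d) ⟩
  ℚ.∣ (a ℚ.- c) ℚ.+ (b ℚ.- d) ∣
    ≤⟨ ℚ.∣p+q∣≤∣p∣+∣q∣ (a ℚ.- c) (b ℚ.- d) ⟩
  ℚ.∣ a ℚ.- c ∣ ℚ.+ ℚ.∣ b ℚ.- d ∣
    ≤⟨ ℚ.+-mono-≤ (regular x _ _) (regular y _ _) ⟩
  (u ℚ.+ v) ℚ.+ (u ℚ.+ v)
    ≃⟨ solve 2 (λ u v → (u :+ v) :+ (u :+ v) := (u :+ u) :+ (v :+ v)) ℚ.≃-refl u v ⟩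
  (u ℚ.+ u) ℚ.+ (v ℚ.+ v)
    ≃⟨ ℚ.+-cong (1/1+-half m) (1/1+-half n) ⟩
  1/1+ m ℚ.+ 1/1+ n ∎
  where
  open ℚ.≤-Reasoning
  open ℚ-Solver.+-*-Solver
  a = seq x (suc (m ℕ.+ m))
  b = seq y (suc (m ℕ.+ m))
  c = seq x (suc (n ℕ.+ n))
  d = seq y (suc (n ℕ.+ n))
  u = 1/1+ suc (m ℕ.+ m)
  v = 1/1+ suc (n ℕ.+ n)

sumℝ : List ℝ → ℝ
sumℝ = foldr _+ℝ_ 0ℝ

∣p∣≤1+∣↥p∣ : ∀ p → ℚ.∣ p ∣ ℚ.≤ ℤ.+ suc ℤ.∣ ↥ p ∣ ℚ./ 1
∣p∣≤1+∣↥p∣ (mkℚᵘ n d) = ℚ.*≤* (subst₂ ℤ._≤_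
  (ℤ.pos-* ℤ.∣ n ∣ 1) (ℤ.pos-* (suc ℤ.∣ n ∣) (suc d))
  (ℤ.+≤+ (ℕ.*-mono-≤ (ℕ.n≤1+n ℤ.∣ n ∣) (s≤s z≤n))))

infixr 7 _·ℝ_

_·ℝ_ : ℚᵘ → ℝ → ℝ
seq     (q ·ℝ x) n   = q ℚ.* seq x (n ℕ.+ ℤ.∣ ↥ q ∣ ℕ.* suc n)
regular (q ·ℝ x) m n = begin
  ℚ.∣ q ℚ.* a ℚ.- q ℚ.* b ∣
    ≃⟨ ℚ.∣-∣-cong (solve 3 (λ q a b → q :* a :- q :* b := q :* (a :- b)) ℚ.≃-refl q a b) ⟩
  ℚ.∣ q ℚ.* (a ℚ.- b) ∣
    ≃⟨ ℚ.∣p*q∣≃∣p∣*∣q∣ q (a ℚ.- b) ⟩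
  ℚ.∣ q ∣ ℚ.* ℚ.∣ a ℚ.- b ∣
    ≤⟨ ℚ.*-mono-≤-nonNeg {{ℚ.∣-∣-nonNeg q}} {{ℚ.∣-∣-nonNeg (a ℚ.- b)}} (∣p∣≤1+∣↥p∣ q) (regular x _ _) ⟩
  (ℤ.+ suc k ℚ./ 1) ℚ.* (1/1+ i ℚ.+ 1/1+ j)
    ≃⟨ ℚ.*-distribˡ-+ (ℤ.+ suc k ℚ./ 1) (1/1+ i) (1/1+ j) ⟩
  (ℤ.+ suc k ℚ./ 1) ℚ.* 1/1+ i ℚ.+ (ℤ.+ suc k ℚ./ 1) ℚ.* 1/1+ j
    ≃⟨ ℚ.+-cong (1/1+-scale k m) (1/1+-scale k n) ⟩
  1/1+ m ℚ.+ 1/1+ n ∎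
  where
  open ℚ.≤-Reasoning
  open ℚ-Solver.+-*-Solver
  k = ℤ.∣ ↥ q ∣
  i = m ℕ.+ k ℕ.* suc m
  j = n ℕ.+ k ℕ.* suc n
  a = seq x i
  b = seq x j

-- Binary logarithm of a rational number q = a/b ≥ 1.
-- The n-th approximation is ⌊N lg q⌋/N with N = n+1, and
-- ⌊N lg q⌋ = ⌊lg ⌊aᴺ/bᴺ⌋⌋.

2^⌊log₂⌋≤ : ∀ n → 1 ℕ.≤ n → 2 ^ ⌊log₂ n ⌋ ℕ.≤ n
2^⌊log₂⌋≤ = <-rec _ step
  where
  open ℕ.≤-Reasoning
  step : ∀ n → (∀ {m} → m ℕ.< n → 1 ℕ.≤ m → 2 ^ ⌊log₂ m ⌋ ℕ.≤ m) →
         1 ℕ.≤ n → 2 ^ ⌊log₂ n ⌋ ℕ.≤ n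
  step 1             _   _ = ℕ.≤-refl
  step n@(suc (suc k)) rec _ = begin
    2 ^ ⌊log₂ n ⌋                  ≡⟨ cong (2 ^_) (sym (ℕ.m+[n∸m]≡n 1≤log)) ⟩
    2 ℕ.* 2 ^ (⌊log₂ n ⌋ ℕ.∸ 1)    ≡⟨ cong (λ l → 2 ℕ.* 2 ^ l) (sym (⌊log₂⌊n/2⌋⌋≡⌊log₂n⌋∸1 n)) ⟩
    2 ℕ.* 2 ^ ⌊log₂ ℕ.⌊ n /2⌋ ⌋    ≤⟨ ℕ.*-monoʳ-≤ 2 (rec (ℕ.⌊n/2⌋<n (suc k)) (s≤s z≤n)) ⟩
    2 ℕ.* ℕ.⌊ n /2⌋                ≡⟨ cong (ℕ.⌊ n /2⌋ ℕ.+_) (ℕ.+-identityʳ _) ⟩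
    ℕ.⌊ n /2⌋ ℕ.+ ℕ.⌊ n /2⌋        ≤⟨ ℕ.+-monoʳ-≤ ℕ.⌊ n /2⌋ (ℕ.⌊n/2⌋≤⌈n/2⌉ n) ⟩
    ℕ.⌊ n /2⌋ ℕ.+ ℕ.⌈ n /2⌉        ≡⟨ ℕ.⌊n/2⌋+⌈n/2⌉≡n n ⟩
    n                              ∎
    where
    1≤log : 1 ℕ.≤ ⌊log₂ n ⌋
    1≤log = ⌊log₂⌋-mono-≤ {2} {n} (s≤s (s≤s z≤n))

<2^1+⌊log₂⌋ : ∀ n → n ℕ.< 2 ^ suc ⌊log₂ n ⌋
<2^1+⌊log₂⌋ n = ℕ.≰⇒> λ 2^≤n → ℕ.<-irrefl refl
  (subst (ℕ._≤ ⌊log₂ n ⌋) (⌊log₂[2^n]⌋≡n (suc ⌊log₂ n ⌋)) (⌊log₂⌋-mono-≤ 2^≤n))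

^-distrib-* : ∀ x y n → (x ℕ.* y) ^ n ≡ x ^ n ℕ.* y ^ n
^-distrib-* x y zero    = refl
^-distrib-* x y (suc n) = trans (cong (x ℕ.* y ℕ.*_) (^-distrib-* x y n))
  (solve 4 (λ x y p q → x :* y :* (p :* q) := x :* p :* (y :* q)) refl x y (x ^ n) (y ^ n))
  where open ℕ-Solver.+-*-Solver

⌊lg⟨_/_⟩^_⌋ : (a b N : ℕ) .{{_ : NonZero b}} → ℕ
⌊lg⟨ a / b ⟩^ N ⌋ = ⌊log₂ (ℕ._/_ (a ^ N) (b ^ N) {{ℕ.m^n≢0 b N}}) ⌋

module _ {a b : ℕ} .{{b≢0 : NonZero b}} (b≤a : b ℕ.≤ a) where

  open ℕ.≤-Reasoning

  ⌊lg⌋-lower : ∀ N → 2 ^ ⌊lg⟨ a / b ⟩^ N ⌋ ℕ.* b ^ N ℕ.≤ a ^ N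
  ⌊lg⌋-lower N = ℕ.≤-trans
    (ℕ.*-monoˡ-≤ (b ^ N) (2^⌊log₂⌋≤ _ (m≥n⇒m/n>0 (ℕ.^-monoˡ-≤ N b≤a))))
    (m/n*n≤m (a ^ N) (b ^ N))
    where instance _ = ℕ.m^n≢0 b N

  ⌊lg⌋-upper : ∀ N → a ^ N ℕ.< 2 ^ suc ⌊lg⟨ a / b ⟩^ N ⌋ ℕ.* b ^ N
  ⌊lg⌋-upper N = begin-strict
    a ^ N                                      ≡⟨ m≡m%n+[m/n]*n (a ^ N) (b ^ N) ⟩
    a ^ N ℕ.% b ^ N ℕ.+ a ^ N ℕ./ b ^ N ℕ.* b ^ N <⟨ ℕ.+-monoˡ-< _ (m%n<n (a ^ N) (b ^ N)) ⟩
    suc (a ^ N ℕ./ b ^ N) ℕ.* b ^ N            ≤⟨ ℕ.*-monoˡ-≤ (b ^ N) (<2^1+⌊log₂⌋ (a ^ N ℕ./ b ^ N)) ⟩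
    2 ^ suc ⌊lg⟨ a / b ⟩^ N ⌋ ℕ.* b ^ N          ∎
    where instance _ = ℕ.m^n≢0 b N

  ⌊lg⌋-cross : ∀ M N .{{_ : NonZero M}} → ⌊lg⟨ a / b ⟩^ M ⌋ ℕ.* N ℕ.≤ suc ⌊lg⟨ a / b ⟩^ N ⌋ ℕ.* M
  ⌊lg⌋-cross M N = ℕ.≮⇒≥ λ l<k → ℕ.<-irrefl refl (begin-strict
    2 ^ (l ℕ.* M) ℕ.* b ^ (M ℕ.* N)
      ≤⟨ ℕ.*-monoˡ-≤ (b ^ (M ℕ.* N)) (ℕ.^-monoʳ-≤ 2 (ℕ.<⇒≤ l<k)) ⟩
    2 ^ (k ℕ.* N) ℕ.* b ^ (M ℕ.* N)
      ≡⟨ pow k M N ⟨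
    (2 ^ k ℕ.* b ^ M) ^ N
      ≤⟨ ℕ.^-monoˡ-≤ N (⌊lg⌋-lower M) ⟩
    (a ^ M) ^ N
      ≡⟨ trans (ℕ.^-*-assoc a M N) (trans (cong (a ^_) (ℕ.*-comm M N)) (sym (ℕ.^-*-assoc a N M))) ⟩
    (a ^ N) ^ M
      <⟨ ℕ.^-monoˡ-< M (⌊lg⌋-upper N) ⟩
    (2 ^ l ℕ.* b ^ N) ^ M
      ≡⟨ trans (pow l N M) (cong (λ e → 2 ^ (l ℕ.* M) ℕ.* b ^ e) (ℕ.*-comm N M)) ⟩
    2 ^ (l ℕ.* M) ℕ.* b ^ (M ℕ.* N) ∎)
    where
    k = ⌊lg⟨ a / b ⟩^ M ⌋
    l = suc ⌊lg⟨ a / b ⟩^ N ⌋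
    pow : ∀ e A B → (2 ^ e ℕ.* b ^ A) ^ B ≡ 2 ^ (e ℕ.* B) ℕ.* b ^ (A ℕ.* B)
    pow e A B = trans (^-distrib-* (2 ^ e) (b ^ A) B)
      (cong₂ ℕ._*_ (ℕ.^-*-assoc 2 e B) (ℕ.^-*-assoc b A B))

∣p-q∣≤ : ∀ {p q r} → p ℚ.≤ q ℚ.+ r → q ℚ.≤ p ℚ.+ r → ℚ.∣ p ℚ.- q ∣ ℚ.≤ r
∣p-q∣≤ {p} {q} {r} p≤q+r q≤p+r with ℚ.∣p∣≡p∨∣p∣≡-p (p ℚ.- q)
... | inj₁ eq = begin
  ℚ.∣ p ℚ.- q ∣      ≡⟨ eq ⟩
  p ℚ.- q            ≤⟨ ℚ.+-monoˡ-≤ (ℚ.- q) p≤q+r ⟩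
  (q ℚ.+ r) ℚ.- q    ≃⟨ solve 2 (λ q r → (q :+ r) :- q := r) ℚ.≃-refl q r ⟩
  r                  ∎
  where open ℚ.≤-Reasoning; open ℚ-Solver.+-*-Solver
... | inj₂ eq = begin
  ℚ.∣ p ℚ.- q ∣      ≡⟨ eq ⟩
  ℚ.- (p ℚ.- q)      ≃⟨ solve 2 (λ p q → :- (p :- q) := q :- p) ℚ.≃-refl p q ⟩
  q ℚ.- p            ≤⟨ ℚ.+-monoˡ-≤ (ℚ.- p) q≤p+r ⟩
  (p ℚ.+ r) ℚ.- p    ≃⟨ solve 2 (λ p r → (p :+ r) :- p := r) ℚ.≃-refl p r ⟩
  r                  ∎
  where open ℚ.≤-Reasoning; open ℚ-Solver.+-*-Solver

k/M≤l/N+1/N : ∀ {k l m n} → k ℕ.* suc n ℕ.≤ suc l ℕ.* suc m →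
              ℤ.+ k ℚ./ suc m ℚ.≤ ℤ.+ l ℚ./ suc n ℚ.+ 1/1+ n
k/M≤l/N+1/N {k} {l} {m} {n} le = ℚ.≤-trans {j = ℤ.+ suc l ℚ./ suc n}
  (ℚ.*≤* (subst₂ ℤ._≤_ (ℤ.pos-* k (suc n)) (ℤ.pos-* (suc l) (suc m)) (ℤ.+≤+ le)))
  (ℚ.≤-reflexive (ℚ.*≡* (solve 2 (λ l N →
    (con (ℤ.+ 1) :+ l) :* (N :* N) := (l :* N :+ con (ℤ.+ 1) :* N) :* N)
    refl (ℤ.+ l) (ℤ.+ suc n))))
  where open ℤ-Solver.+-*-Solver

1≤q⇒↧≤↥ : ∀ {q} → 1ℚᵘ ℚ.≤ q → ↧ₙ q ℕ.≤ ℤ.∣ ↥ q ∣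
1≤q⇒↧≤↥ {mkℚᵘ (ℤ.+ a) b} (ℚ.*≤* le) = ℤ.drop‿+≤+ (subst₂ ℤ._≤_
  (ℤ.*-identityˡ (ℤ.+ suc b)) (ℤ.*-identityʳ (ℤ.+ a)) le)

lg : (q : ℚᵘ) → .(1ℚᵘ ℚ.≤ q) → ℝ
lg q 1≤q = mkℝ approx λ m n → ∣p-q∣≤
  (bound m n (ℚ.p≤q+p (1/1+ n) (1/1+ m)))
  (bound n m (ℚ.p≤p+q (1/1+ m) (1/1+ n)))
  where
  a = ℤ.∣ ↥ q ∣
  b = ↧ₙ q

  approx : ℕ → ℚᵘ
  approx n = ℤ.+ ⌊lg⟨ a / b ⟩^ suc n ⌋ ℚ./ suc n

  b≤a : b ℕ.≤ a
  b≤a = 1≤q⇒↧≤↥ (recompute (1ℚᵘ ℚ.≤? q) 1≤q)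

  bound : ∀ m n {e} → 1/1+ n ℚ.≤ e → approx m ℚ.≤ approx n ℚ.+ e
  bound m n 1/n≤e = ℚ.≤-trans
    (k/M≤l/N+1/N {⌊lg⟨ a / b ⟩^ suc m ⌋} {⌊lg⟨ a / b ⟩^ suc n ⌋} {m} {n}
      (⌊lg⌋-cross b≤a (suc m) (suc n)))
    (ℚ.+-monoʳ-≤ (approx n) 1/n≤e)

module _ {A : Set} (_≟_ : DecidableEquality A) where

  count : A → List A → ℕ
  count x = length ∘ filter (x ≟_)

  entropyTerm : ∀ S {x} → x ∈ S → ℝ
  entropyTerm S {x} x∈S = (ℤ.+ nₓ ℚ./ n) ·ℝ lg (ℤ.+ n ℚ./ nₓ) 1≤n/nₓ
    where
    n  = length S
    nₓ = count x S

    nₓ≤n : nₓ ℕ.≤ n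
    nₓ≤n = length-filter (x ≟_) S

    instance
      nₓ≢0 : NonZero nₓ
      nₓ≢0 = ℕ.>-nonZero (filter-some (x ≟_) x∈S)

      n≢0 : NonZero n
      n≢0 = ℕ.>-nonZero (ℕ.≤-trans (ℕ.>-nonZero⁻¹ nₓ) nₓ≤n)

    1≤n/nₓ : 1ℚᵘ ℚ.≤ ℤ.+ n ℚ./ nₓ
    1≤n/nₓ = ℚ.*≤* (subst₂ ℤ._≤_
      (sym (trans (ℤ.*-identityˡ _) (ℚ.↧[n/d]≡d (ℤ.+ n) nₓ)))
      (sym (trans (ℤ.*-identityʳ _) (ℚ.↥[n/d]≡n (ℤ.+ n) nₓ)))
      (ℤ.+≤+ nₓ≤n))

  H₀ : List A → ℝ
  H₀ S = sumℝ (mapWith∈ (deduplicate _≟_ S) (entropyTerm S ∘ ∈-deduplicate⁻ _≟_ S))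

rotate : ∀ {A : Set} → List⁺ A → List⁺ A
rotate (x ∷ xs) = xs ∷ʳ x

length-filter-mono : ∀ {A : Set} {P Q : A → Set} (P? : ∀ x → Dec (P x)) (Q? : ∀ x → Dec (Q x)) →
                     (∀ {x} → P x → Q x) → ∀ xs → length (filter P? xs) ℕ.≤ length (filter Q? xs)
length-filter-mono P? Q? P⊆Q []       = z≤n
length-filter-mono P? Q? P⊆Q (x ∷ xs) with P? x | Q? x | length-filter-mono P? Q? P⊆Q xs
... | yes p | yes _ | ih = s≤s ih
... | yes p | no ¬q | _  = contradiction (P⊆Q p) ¬q
... | no _  | yes _ | ih = ℕ.m≤n⇒m≤1+n ih
... | no _  | no _  | ih = ih

module Strings {A : Set} {_<_ : Rel A 0ℓ} (isSTO : IsStrictTotalOrder _≡_ _<_) where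

  open IsStrictTotalOrder isSTO using (_≟_; _<?_; compare; irrefl)
    renaming (trans to <-trans)

  strictTotalOrder : StrictTotalOrder 0ℓ 0ℓ 0ℓ
  strictTotalOrder = record { isStrictTotalOrder = isSTO }

  lexOrder : DecTotalOrder 0ℓ 0ℓ 0ℓ
  lexOrder = On.decTotalOrder (≤-decTotalOrder strictTotalOrder) (toList {A = A})

  rotations : List⁺ A → List (List⁺ A)
  rotations T = iterate rotate T (List⁺.length T)

  bwt : List⁺ A → List A
  bwt T = List.map List⁺.last (sort lexOrder (rotations T))

  length-bwt : ∀ T → length (bwt T) ≡ List⁺.length T
  length-bwt T = begin
    length (bwt T)                       ≡⟨ length-map List⁺.last (sort lexOrder (rotations T)) ⟩
    length (sort lexOrder (rotations T)) ≡⟨ ↭-length (sort-↭ lexOrder (rotations T)) ⟩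
    length (rotations T)                 ≡⟨ length-iterate rotate T (List⁺.length T) ⟩
    List⁺.length T                       ∎
    where open ≡-Reasoning

  _≤?_ : ∀ v w → Dec (v < w ⊎ v ≡ w)
  v ≤? w = (v <? w) ⊎-dec (v ≟ w)

  #< #≤ : A → List A → ℕ
  #< w = length ∘ filter (_<? w)
  #≤ w = length ∘ filter (_≤? w)

  C : List⁺ A → A → ℕ
  C T w = #< w (toList T)

  -- C[w+1], the number of symbols of T that are ≤ w
  C⁺ : List⁺ A → A → ℕ
  C⁺ T w = #≤ w (toList T)

  InBlock : ℕ → A → List A → Set
  InBlock i w xs = #< w xs ℕ.≤ i × i ℕ.< #≤ w xs

  #≤≤#< : ∀ {v w} → v < w → ∀ xs → #≤ v xs ℕ.≤ #< w xs
  #≤≤#< v<w = length-filter-mono _ _ λ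
    { (inj₁ x<v) → <-trans x<v v<w ; (inj₂ refl) → v<w }

  #<≤#≤ : ∀ w xs → #< w xs ℕ.≤ #≤ w xs
  #<≤#≤ w = length-filter-mono _ _ inj₁

  inBlock-∷ : ∀ x xs i → i ℕ.≤ length xs →
              (∀ {j} → j ℕ.< length xs → ∃ λ w → InBlock j w xs) →
              ∃ λ w → InBlock i w (x ∷ xs)
  inBlock-∷ x xs i i≤n rec with i ℕ.<? #< x xs | i ℕ.≤? #≤ x xs
  ... | yes i<#<x | _
      with v , #<v≤i , i<#≤v ← rec (ℕ.<-≤-trans i<#<x (length-filter (_<? x) xs))
      with compare v x
  ...   | tri< v<x _ x≮v = v
          , subst (ℕ._≤ i) (sym (cong length (filter-reject (_<? v) x≮v))) #<v≤i
          , subst (i ℕ.<_) (sym (cong length (filter-reject (_≤? v)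
              λ { (inj₁ x<v) → x≮v x<v ; (inj₂ refl) → irrefl refl v<x }))) i<#≤v
  ...   | tri≈ _ refl _ = contradiction i<#<x (ℕ.≤⇒≯ #<v≤i)
  ...   | tri> _ _ x<v  = contradiction i<#<x
          (ℕ.≤⇒≯ (ℕ.≤-trans (#<≤#≤ x xs) (ℕ.≤-trans (#≤≤#< x<v xs) #<v≤i)))
  inBlock-∷ x xs i i≤n rec | no i≮#<x | yes i≤#≤x = x
    , subst (ℕ._≤ i) (sym (cong length (filter-reject (_<? x) (irrefl refl)))) (ℕ.≮⇒≥ i≮#<x)
    , subst (i ℕ.<_) (sym (cong length (filter-accept (_≤? x) (inj₂ refl)))) (s≤s i≤#≤x)
  inBlock-∷ x xs zero    i≤n rec | no _ | no i≰#≤x = contradiction z≤n i≰#≤x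
  inBlock-∷ x xs (suc j) i≤n rec | no _ | no i≰#≤x
      with v , #<v≤j , j<#≤v ← rec i≤n
      with compare v x
  ... | tri< v<x _ _  = contradiction
        (ℕ.≤-trans j<#≤v (ℕ.≤-trans (#≤≤#< v<x xs) (#<≤#≤ x xs))) i≰#≤x
  ... | tri≈ _ refl _ = contradiction j<#≤v i≰#≤x
  ... | tri> _ _ x<v  = v
        , subst (ℕ._≤ suc j) (sym (cong length (filter-accept (_<? v) x<v))) (s≤s #<v≤j)
        , subst (suc j ℕ.<_) (sym (cong length (filter-accept (_≤? v) (inj₁ x<v)))) (s≤s j<#≤v)

  inBlock-exists : ∀ xs {i} → i ℕ.< length xs → ∃ λ w → InBlock i w xs
  inBlock-exists (x ∷ xs) {i} (s≤s i≤n) = inBlock-∷ x xs i i≤n (inBlock-exists xs)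

  inBlock-unique : ∀ xs {i v w} → InBlock i v xs → InBlock i w xs → v ≡ w
  inBlock-unique xs {_} {v} {w} (#<v≤i , i<#≤v) (#<w≤i , i<#≤w) with compare v w
  ... | tri< v<w _ _ = contradiction (ℕ.≤-trans i<#≤v (ℕ.≤-trans (#≤≤#< v<w xs) #<w≤i)) (ℕ.<-irrefl refl)
  ... | tri≈ _ v≡w _ = v≡w
  ... | tri> _ _ w<v = contradiction (ℕ.≤-trans i<#≤w (ℕ.≤-trans (#≤≤#< w<v xs) #<v≤i)) (ℕ.<-irrefl refl)

  blockSymbol : ∀ T {i} → i ℕ.< List⁺.length T →
                ∃! _≡_ (λ w → C T w ℕ.≤ i × i ℕ.< C⁺ T w)
  blockSymbol T i<n with w , w∈ ← inBlock-exists (toList T) i<n =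
    w , w∈ , inBlock-unique (toList T) w∈

  -- the pairs (T[i], T[i+1]), with T read cyclically
  bigrams : List⁺ A → List (A × A)
  bigrams T = zip (toList T) (toList (rotate T))

  bigramCount : List⁺ A → A → A → ℕ
  bigramCount T w w′ = count (×-≡-dec _≟_ _≟_) (w , w′) (bigrams T)

record RoadNetwork : Set₁ where
  field
    V      : Set
    E      : Set
    source : E → V
    target : E → V

    ∣E∣      : ℕ
    E-finite : E ↔ Fin ∣E∣

    _<ᴱ_ : Rel E 0ℓ
    <ᴱ-isStrictTotalOrder : IsStrictTotalOrder _≡_ _<ᴱ_

module Trajectories (G : RoadNetwork) where

  open RoadNetwork G

  -- network-constrained trajectories
  record NCT : Set where
    field
      segments  : List⁺ E
      connected : Linked (λ e f → target e ≡ source f) (toList segments)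

  open NCT public

  data Symbol : Set where
    #   : Symbol
    $   : Symbol
    seg : E → Symbol

  σ : ℕ
  σ = ∣E∣ ℕ.+ 2

  data _<_ : Rel Symbol 0ℓ where
    #<$     : # < $
    #<seg   : ∀ {e} → # < seg e
    $<seg   : ∀ {e} → $ < seg e
    seg<seg : ∀ {e f} → e <ᴱ f → seg e < seg f

  <-trans : Transitive _<_
  <-trans #<$         $<seg         = #<seg
  <-trans #<seg       (seg<seg _)   = #<seg
  <-trans $<seg       (seg<seg _)   = $<seg
  <-trans (seg<seg p) (seg<seg q)   = seg<seg (IsStrictTotalOrder.trans <ᴱ-isStrictTotalOrder p q)

  <-compare : Trichotomous _≡_ _<_
  <-compare #       #       = tri≈ (λ ()) refl (λ ())
  <-compare #       $       = tri< #<$ (λ ()) (λ ())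
  <-compare #       (seg _) = tri< #<seg (λ ()) (λ ())
  <-compare $       #       = tri> (λ ()) (λ ()) #<$
  <-compare $       $       = tri≈ (λ ()) refl (λ ())
  <-compare $       (seg _) = tri< $<seg (λ ()) (λ ())
  <-compare (seg _) #       = tri> (λ ()) (λ ()) #<seg
  <-compare (seg _) $       = tri> (λ ()) (λ ()) $<seg
  <-compare (seg e) (seg f) with IsStrictTotalOrder.compare <ᴱ-isStrictTotalOrder e f
  ... | tri< e<f e≢f e≯f = tri< (seg<seg e<f) (λ { refl → e≢f refl }) λ { (seg<seg p) → e≯f p }
  ... | tri≈ e≮f refl e≯f = tri≈ (λ { (seg<seg p) → e≮f p }) refl λ { (seg<seg p) → e≯f p }
  ... | tri> e≮f e≢f f<e = tri> (λ { (seg<seg p) → e≮f p }) (λ { refl → e≢f refl }) (seg<seg f<e)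

  <-isStrictTotalOrder : IsStrictTotalOrder _≡_ _<_
  <-isStrictTotalOrder = isStrictTotalOrderᶜ record
    { isEquivalence = isEquivalence
    ; trans         = <-trans
    ; compare       = <-compare
    }

  open Strings <-isStrictTotalOrder public

  trajectoryString : List⁺ NCT → List⁺ Symbol
  trajectoryString Ts = concatMap (λ t → reversed t ++ $ ∷ []) (toList Ts) ∷ʳ #
    where
    reversed : NCT → List Symbol
    reversed t = List.map seg (List.reverse (toList (segments t)))

  -- w ∈ N_out(w′), i.e. the edge (w′, w) of the ET-graph.
  _∈Nout[_]_ : Symbol → List⁺ Symbol → Symbol → Set
  w ∈Nout[ T ] w′ = (w , w′) ∈ bigrams T

  -- Relative movement labelings: label w w′ is φ(w|w′); its values off N_out(w′) are unconstrained.
  record RML (T : List⁺ Symbol) : Set where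
    field
      label       : Symbol → Symbol → ℕ
      label-range : ∀ {w w′} → w ∈Nout[ T ] w′ → 1 ℕ.≤ label w w′ × label w w′ ℕ.≤ σ
      label-inj   : ∀ {v w w′} → v ∈Nout[ T ] w′ → w ∈Nout[ T ] w′ →
                    label v w′ ≡ label w w′ → v ≡ w

  open RML public

  IsBigramOrdered : ∀ {T} → RML T → Set
  IsBigramOrdered {T} φ = ∀ w′ → ∃ λ ws →
      Unique ws
    × (∀ w → w ∈ ws ⇔ w ∈Nout[ T ] w′)
    × AllPairs (λ u v → bigramCount T v w′ ℕ.≤ bigramCount T u w′) ws
    × (∀ i → label φ (lookup ws i) w′ ≡ suc (toℕ i))

  labeledBWT : ∀ T → RML T → List ℕ
  labeledBWT T φ = tabulate {n = List⁺.length T} λ i →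
    label φ (lookup (bwt T) (cast (sym (length-bwt T)) i))
            (proj₁ (blockSymbol T (toℕ<n i)))

{-# OPTIONS --safe #-}
module Submission where

-- With n = |S| and c_s the number of occurrences of s in S, n H₀(S) = lg (nⁿ / ∏_{s ∈ S} c_s), the
-- product running over the positions of S. Hence a larger product of multiplicities, which is also
-- ∏_x (c_x)^(c_x) over the distinct symbols x, means a smaller entropy. As m ↦ m^m is
-- multiplicatively convex, it is a product of powers of factors ≥ 1 whose exponents are the excesses
-- max (m - t, 0), so it is enough to compare the sums Σ_x max (c_x - t, 0) for every t. Such a sum
-- only involves the set J of labels with c_x > t, and thus reduces to: any k labels of φ together
-- occur at most as often as the labels 1, …, k of φ*. By the BWT, labels are counted by bigrams, and
-- for every w′ the labels in J select at most k elements of N_out(w′), whereas the labels 1, …, k of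
-- φ* select the k most frequent ones.

open import Defs
open import Algebra.Bundles using (CommutativeMonoid)
import Algebra.Properties.CommutativeSemigroup as CommutativeSemigroupProperties
open import Data.Fin.Base as Fin using (Fin; toℕ; cast)
open import Data.Fin.Properties using (toℕ<n; toℕ-cast)
import Data.Integer.Base as ℤ
import Data.Integer.Properties as ℤ
open import Data.List.Base as List using (List; []; _∷_; _∷ʳ′_; _++_; _∷ʳ_; map; foldr; length; filter; take; lookup; tabulate; zip; iterate; applyUpTo; concatMap; deduplicate)
open import Data.List.Membership.Propositional using (_∈_; lose; mapWith∈)
open import Data.List.Membership.Propositional.Properties using (∈-deduplicate⁺; ∈-deduplicate⁻; ∈-map⁺; ∈-map⁻; ∈-concatMap⁺; ∈-applyUpTo⁺; ∈-lookup)
open import Data.List.NonEmpty.Base as List⁺ using (List⁺; _∷_; toList)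
open import Data.List.Properties using (length-filter; filter-accept; filter-reject; filter-none; filter-some; length-applyUpTo; length-iterate; length-map; length-++; map-∘; map-++; map-cong; tabulate-cong; ++-assoc; ++-identityʳ; ∷ʳ-injectiveʳ)
open import Data.List.Relation.Binary.Lex.Core using (this; next)
open import Data.List.Relation.Binary.Permutation.Propositional using (_↭_; ↭-sym; ↭-trans; ↭-reflexive)
open import Data.List.Relation.Binary.Permutation.Propositional.Properties using (↭-length; filter-↭; drop-∷; ∷↭∷ʳ) renaming (map⁺ to map-↭)
open import Data.List.Relation.Unary.All as All using (All; []; _∷_)
import Data.List.Relation.Unary.All.Properties as All
open import Data.List.Relation.Unary.AllPairs as AllPairs using (AllPairs; []; _∷_)
import Data.List.Relation.Unary.AllPairs.Properties as AllPairs
open import Data.List.Relation.Unary.Any using (here; there)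
open import Data.List.Relation.Unary.Linked.Properties using (Linked⇒AllPairs)
open import Data.List.Relation.Unary.Unique.DecPropositional.Properties using (deduplicate-!)
open import Data.List.Relation.Unary.Unique.Propositional using (Unique)
import Data.List.Relation.Unary.Unique.Propositional.Properties as Unique
open import Data.List.Sort using (sort; sort-↭; sort-↗)
open import Data.Nat.Base as ℕ using (ℕ; zero; suc; _+_; _*_; _∸_; _^_; _≤_; _<_; NonZero; z≤n; s≤s)
import Data.Nat.GeneralisedArithmetic as ℕ
open import Data.Nat.ListAction using (sum; product)
open import Data.Nat.ListAction.Properties using (sum-++; product≢0; product-↭)
import Data.Nat.Properties as ℕ
open import Data.Nat.Properties using (_≟_)
import Data.Nat.Solver as ℕ-Solver
open import Data.Product using (∃; _×_; _,_; proj₁; proj₂; uncurry)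
open import Data.Product.Properties using (,-injectiveˡ; ,-injectiveʳ) renaming (≡-dec to ×-≡-dec)
import Data.Rational.Unnormalised.Base as ℚ
open ℚ using (ℚᵘ; mkℚᵘ; 0ℚᵘ; 1ℚᵘ; ↧ₙ_)
import Data.Rational.Unnormalised.Properties as ℚ
import Data.Rational.Unnormalised.Solver as ℚ-Solver
open import Data.Sum.Base using (_⊎_; inj₁; inj₂)
open import Function.Base using (_∘_)
open import Function.Bundles using (_⇔_; Equivalence)
open import Level using (0ℓ)
open import Relation.Binary.Bundles using (DecTotalOrder)
open import Relation.Binary.Core using (Rel)
open import Relation.Binary.Definitions using (DecidableEquality)
open import Relation.Binary.PropositionalEquality hiding (J)
open import Relation.Binary.Structures using (IsStrictTotalOrder)
open import Relation.Nullary using (Dec; yes; no; contradiction)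

open CommutativeSemigroupProperties ℕ.+-commutativeSemigroup using () renaming (interchange to +-interchange)
open CommutativeSemigroupProperties ℕ.*-commutativeSemigroup using () renaming (interchange to *-interchange)

private variable
  A B : Set

-- Comparing reals through natural numbers

ι : ℕ → ℚᵘ
ι k = ℤ.+ k ℚ./ 1

ι-mono : ∀ {k l} → k ℕ.≤ l → ι k ℚ.≤ ι l
ι-mono k≤l = ℚ.*≤* (ℤ.*-monoʳ-≤-nonNeg (ℤ.+ 1) (ℤ.+≤+ k≤l))

ι-+ : ∀ k l → ι (k ℕ.+ l) ℚ.≃ ι k ℚ.+ ι l
ι-+ k l = ℚ.*≡* (cong (ℤ._* ℤ.+ 1) (trans (ℤ.pos-+ k l)
  (sym (cong₂ ℤ._+_ (ℤ.*-identityʳ (ℤ.+ k)) (ℤ.*-identityʳ (ℤ.+ l))))))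

ι-* : ∀ k l → ι (k ℕ.* l) ℚ.≃ ι k ℚ.* ι l
ι-* k l = ℚ.*≡* (cong (ℤ._* ℤ.+ 1) (ℤ.pos-* k l))

1/1+-anti : ∀ {m n} → m ℕ.≤ n → 1/1+ n ℚ.≤ 1/1+ m
1/1+-anti m≤n = ℚ.*≤* (ℤ.*-monoˡ-≤-nonNeg (ℤ.+ 1) (ℤ.+≤+ (s≤s m≤n)))

k/1+ : ∀ k n → ℤ.+ k ℚ./ suc n ℚ.≃ ι k ℚ.* 1/1+ n
k/1+ k n = ℚ.*≡* (cong₂ ℤ._*_ (sym (ℤ.*-identityʳ (ℤ.+ k))) (cong (λ x → ℤ.+ suc x) (ℕ.+-identityʳ n)))

-- If q < p, then p - q is at least 1/d for its denominator d, whereas the error at m = e * d is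
-- e/(e * d + 1) < 1/d.
archimedean : ∀ {p q} e → (∀ m → p ℚ.≤ q ℚ.+ ι e ℚ.* 1/1+ m) → p ℚ.≤ q
archimedean {p} {q} e p≤ = ℚ.≮⇒≥ λ q<p → ℚ.<-irrefl ℚ.≃-refl (begin-strict
    p                                  ≤⟨ p≤ m ⟩
    q ℚ.+ ι e ℚ.* 1/1+ m               <⟨ ℚ.+-monoʳ-< q (small q<p) ⟩
    q ℚ.+ (p ℚ.- q)                    ≃⟨ solve 2 (λ p q → q :+ (p :- q) := p) ℚ.≃-refl p q ⟩
    p                                  ∎)
  where
  open ℚ.≤-Reasoning
  open ℚ-Solver.+-*-Solver
  m = e ℕ.* ↧ₙ (p ℚ.- q)

  below : ∀ {r} → 0ℚᵘ ℚ.< r → ι e ℚ.* 1/1+ (e ℕ.* ↧ₙ r) ℚ.< r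
  below {mkℚᵘ (ℤ.+ zero) d}  (ℚ.*<* 0<0) with () ← ℤ.drop‿+<+ 0<0
  below {mkℚᵘ (ℤ.+ suc k) d} _ = ℚ.<-respˡ-≃ (k/1+ e (e ℕ.* suc d)) (ℚ.*<* (subst₂ ℤ._<_
    (ℤ.pos-* e (suc d)) (ℤ.pos-* (suc k) (suc (e ℕ.* suc d)))
    (ℤ.+<+ (ℕ.m≤m+n (suc (e ℕ.* suc d)) _))))
  below {mkℚᵘ ℤ.-[1+ k ] d}  (ℚ.*<* ())

  small : q ℚ.< p → ι e ℚ.* 1/1+ m ℚ.< p ℚ.- q
  small q<p = below (ℚ.<-respˡ-≃ (ℚ.+-inverseʳ q) (ℚ.+-monoˡ-< (ℚ.- q) q<p))

-- Inequalities of rationals up to an error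

infix 4 _≤_+[_] _≈[_]_

-- A record, so that p, q and r can be inferred from a proof.
record _≤_+[_] (p q r : ℚᵘ) : Set where
  constructor within
  field bound : p ℚ.≤ q ℚ.+ r

_≈[_]_ : ℚᵘ → ℚᵘ → ℚᵘ → Set
p ≈[ r ] q = p ≤ q +[ r ] × q ≤ p +[ r ]

≤+-trans : ∀ {p q s r t} → p ≤ q +[ r ] → q ≤ s +[ t ] → p ≤ s +[ r ℚ.+ t ]
≤+-trans {p} {q} {s} {r} {t} (within p≤) (within q≤) = within (begin
  p                   ≤⟨ p≤ ⟩
  q ℚ.+ r             ≤⟨ ℚ.+-monoˡ-≤ r q≤ ⟩
  s ℚ.+ t ℚ.+ r       ≃⟨ solve 3 (λ s r t → s :+ t :+ r := s :+ (r :+ t)) ℚ.≃-refl s r t ⟩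
  s ℚ.+ (r ℚ.+ t)     ∎)
  where
  open ℚ.≤-Reasoning
  open ℚ-Solver.+-*-Solver

≤+-resp : ∀ {p p′ q q′ e e′} → p ℚ.≃ p′ → q ℚ.≃ q′ → e ℚ.≤ e′ → p ≤ q +[ e ] → p′ ≤ q′ +[ e′ ]
≤+-resp p≃ q≃ e≤ (within p≤) = within (ℚ.≤-trans (ℚ.≤-reflexive (ℚ.≃-sym p≃))
  (ℚ.≤-trans p≤ (ℚ.+-mono-≤ (ℚ.≤-reflexive q≃) e≤)))

≤+-+ : ∀ {p q s t e f} → p ≤ q +[ e ] → s ≤ t +[ f ] → p ℚ.+ s ≤ q ℚ.+ t +[ e ℚ.+ f ]
≤+-+ {q = q} {t = t} {e} {f} (within p≤) (within s≤) = within (ℚ.≤-trans (ℚ.+-mono-≤ p≤ s≤)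
  (ℚ.≤-reflexive (solve 4 (λ q t e f → q :+ e :+ (t :+ f) := q :+ t :+ (e :+ f)) ℚ.≃-refl q t e f)))
  where open ℚ-Solver.+-*-Solver

≤+-* : ∀ {p q e} k → p ≤ q +[ e ] → ι k ℚ.* p ≤ ι k ℚ.* q +[ ι k ℚ.* e ]
≤+-* {q = q} {e} k (within p≤) = within (ℚ.≤-trans (ℚ.*-monoʳ-≤-nonNeg (ι k) p≤)
  (ℚ.≤-reflexive (ℚ.*-distribˡ-+ (ι k) q e)))

≈-resp : ∀ {p p′ q q′ e e′} → p ℚ.≃ p′ → q ℚ.≃ q′ → e ℚ.≃ e′ → p ≈[ e ] q → p′ ≈[ e′ ] q′
≈-resp p≃ q≃ e≃ (p≤ , q≤) =
  ≤+-resp p≃ q≃ (ℚ.≤-reflexive e≃) p≤ , ≤+-resp q≃ p≃ (ℚ.≤-reflexive e≃) q≤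

≈-trans : ∀ {p q s r t} → p ≈[ r ] q → q ≈[ t ] s → p ≈[ r ℚ.+ t ] s
≈-trans {r = r} {t} (p≤ , q≤) (q≤′ , s≤) = ≤+-trans p≤ q≤′ ,
  ≤+-resp ℚ.≃-refl ℚ.≃-refl (ℚ.≤-reflexive (ℚ.+-comm t r)) (≤+-trans s≤ q≤)

≈-+ : ∀ {p q s t e f} → p ≈[ e ] q → s ≈[ f ] t → p ℚ.+ s ≈[ e ℚ.+ f ] q ℚ.+ t
≈-+ (p≤ , q≤) (s≤ , t≤) = ≤+-+ p≤ s≤ , ≤+-+ q≤ t≤

≈-* : ∀ {p q e} k → p ≈[ e ] q → ι k ℚ.* p ≈[ ι k ℚ.* e ] ι k ℚ.* q
≈-* k (p≤ , q≤) = ≤+-* k p≤ , ≤+-* k q≤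

p≤∣p∣ : ∀ p → p ℚ.≤ ℚ.∣ p ∣
p≤∣p∣ (mkℚᵘ (ℤ.+ n) d)      = ℚ.≤-refl
p≤∣p∣ (mkℚᵘ ℤ.-[1+ n ] d)   = ℚ.*≤* ℤ.-≤+

seq-≤ : ∀ x i j → seq x i ≤ seq x j +[ 1/1+ i ℚ.+ 1/1+ j ]
seq-≤ x i j = within (begin
  p                       ≃⟨ solve 2 (λ p q → p := q :+ (p :- q)) ℚ.≃-refl p q ⟩
  q ℚ.+ (p ℚ.- q)         ≤⟨ ℚ.+-monoʳ-≤ q (ℚ.≤-trans (p≤∣p∣ (p ℚ.- q)) (regular x i j)) ⟩
  q ℚ.+ (1/1+ i ℚ.+ 1/1+ j) ∎)
  where
  open ℚ.≤-Reasoning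
  open ℚ-Solver.+-*-Solver
  p = seq x i
  q = seq x j

-- Regularity, with 1/(i+1) bounded by 1/(m+1). The bound is uniform in i because `_+ℝ_` and `_·ℝ_`
-- read their arguments at later indices.
seq-later : ∀ x {m i} → m ℕ.≤ i → seq x i ≈[ ι 2 ℚ.* 1/1+ m ] seq x m
seq-later x {m} {i} m≤i =
  ≤+-resp ℚ.≃-refl ℚ.≃-refl error (seq-≤ x i m) ,
  ≤+-resp ℚ.≃-refl ℚ.≃-refl (ℚ.≤-trans (ℚ.≤-reflexive (ℚ.+-comm (1/1+ m) (1/1+ i))) error) (seq-≤ x m i)
  where
  open ℚ-Solver.+-*-Solver
  error : 1/1+ i ℚ.+ 1/1+ m ℚ.≤ ι 2 ℚ.* 1/1+ m
  error = ℚ.≤-trans (ℚ.+-monoˡ-≤ (1/1+ m) (1/1+-anti m≤i)) (ℚ.≤-reflexive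
    (solve 1 (λ u → u :+ u := con (ι 2) :* u) ℚ.≃-refl (1/1+ m)))

-- Stated for sequences, as conversion checking at ℝ compares the (huge) regularity proofs.
record Tracks (n : ℕ) (s : ℕ → ℚᵘ) (K : ℕ → ℕ) : Set where
  constructor tracks
  field
    error : ℕ
    near  : ∀ {m i} → m ℕ.≤ i → ι n ℚ.* s i ≈[ ι error ℚ.* 1/1+ m ] ι (K m) ℚ.* 1/1+ m

tracks-0 : ∀ n → Tracks n (seq 0ℝ) λ _ → 0
tracks-0 n = tracks 0 λ {m} _ →
  let 0≃ = ℚ.≃-sym (ℚ.*-zeroˡ (1/1+ m))
  in ≈-resp (ℚ.≃-sym (ℚ.*-zeroʳ (ι n))) 0≃ 0≃ (within ℚ.≤-refl , within ℚ.≤-refl)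

-- The sum reads both arguments at 1 + 2i, which is still at least m, so the approximations and the
-- errors simply add.
tracks-+ : ∀ {n s t K L} → Tracks n s K → Tracks n t L →
           Tracks n (λ i → s (suc (i ℕ.+ i)) ℚ.+ t (suc (i ℕ.+ i))) λ m → K m ℕ.+ L m
tracks-+ {n} {s} {t} {K} {L} (tracks e s≈K) (tracks f t≈L) = tracks (e ℕ.+ f) λ {m} {i} m≤i →
  let m≤1+2i = ℕ.m≤n⇒m≤1+n (ℕ.≤-trans m≤i (ℕ.m≤m+n i i))
  in ≈-resp (ℚ.≃-sym (ℚ.*-distribˡ-+ (ι n) (s _) (t _))) (merge (K m) (L m) m) (merge e f m)
       (≈-+ (s≈K m≤1+2i) (t≈L m≤1+2i))
  where
  merge : ∀ k l m → ι k ℚ.* 1/1+ m ℚ.+ ι l ℚ.* 1/1+ m ℚ.≃ ι (k ℕ.+ l) ℚ.* 1/1+ m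
  merge k l m = ℚ.≃-trans (ℚ.≃-sym (ℚ.*-distribʳ-+ (1/1+ m) (ι k) (ι l)))
    (ℚ.*-cong (ℚ.≃-sym (ι-+ k l)) (ℚ.≃-refl {1/1+ m}))

-- The constant d becomes d/(m+1) on the scale of `Tracks`. Hence at every index j the required
-- inequality, multiplied by n, holds up to E/(m+1) for all m, and `archimedean` removes this error.
tracks-≤ : ∀ {n K L} x y d .{{_ : NonZero n}} → Tracks n (seq x) K → Tracks n (seq y) L →
           (∀ m → K m ℕ.≤ L m ℕ.+ d) → x ≤ℝ y
tracks-≤ {n@(suc _)} {K} {L} x y d (tracks e x≈K) (tracks f y≈L) K≤L j =
  ℚ.*-cancelˡ-≤-pos (ι n) (archimedean E bound)
  where
  N = ι n
  E = n ℕ.+ e ℕ.+ d ℕ.+ f ℕ.+ n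
  bound : ∀ m → N ℚ.* seq x j ℚ.≤ N ℚ.* (seq y j ℚ.+ ℤ.+ 2 ℚ./ suc j) ℚ.+ ι E ℚ.* 1/1+ m
  bound m = begin
    N ℚ.* seq x j
      -- The chain runs from x at j through x at m, K m, L m and y at m to y at j. The two changes
      -- of index cost n (u + v) each: their v parts make up the slack 2/(j+1) of `_≤ℝ_`, their u
      -- parts the two summands n of E.
      ≤⟨ _≤_+[_].bound (≤+-trans (≤+-* n (seq-≤ x j m)) (≤+-trans (proj₁ (x≈K {m} ℕ.≤-refl)) (≤+-trans K≤L·u
           (≤+-trans (proj₂ (y≈L {m} ℕ.≤-refl)) (≤+-* n (seq-≤ y m j)))))) ⟩
    N ℚ.* seq y j ℚ.+ (N ℚ.* (v ℚ.+ u) ℚ.+ (ι e ℚ.* u ℚ.+ (ι d ℚ.* u ℚ.+ (ι f ℚ.* u ℚ.+ N ℚ.* (u ℚ.+ v)))))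
      ≃⟨ solve 7 (λ N y u v e d f →
           N :* y :+ (N :* (v :+ u) :+ (e :* u :+ (d :* u :+ (f :* u :+ N :* (u :+ v))))) :=
           N :* (y :+ con (ι 2) :* v) :+ (N :+ e :+ d :+ f :+ N) :* u)
           ℚ.≃-refl N (seq y j) u v (ι e) (ι d) (ι f) ⟩
    N ℚ.* (seq y j ℚ.+ ι 2 ℚ.* v) ℚ.+ (N ℚ.+ ι e ℚ.+ ι d ℚ.+ ι f ℚ.+ N) ℚ.* u
      ≃⟨ ℚ.+-cong (ℚ.*-cong (ℚ.≃-refl {N}) (ℚ.+-congʳ (seq y j) (k/1+ 2 j)))
                  (ℚ.*-cong split (ℚ.≃-refl {u})) ⟨
    N ℚ.* (seq y j ℚ.+ ℤ.+ 2 ℚ./ suc j) ℚ.+ ι E ℚ.* u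
      ∎
    where
    open ℚ.≤-Reasoning
    open ℚ-Solver.+-*-Solver
    u = 1/1+ m
    v = 1/1+ j
    K≤L·u : ι (K m) ℚ.* u ≤ ι (L m) ℚ.* u +[ ι d ℚ.* u ]
    K≤L·u = within (ℚ.≤-trans (ℚ.*-monoˡ-≤-nonNeg u {{_}} (ι-mono (K≤L m))) (ℚ.≤-reflexive
      (ℚ.≃-trans (ℚ.*-cong (ι-+ (L m) d) (ℚ.≃-refl {u})) (ℚ.*-distribʳ-+ u (ι (L m)) (ι d)))))
    split : ι E ℚ.≃ N ℚ.+ ι e ℚ.+ ι d ℚ.+ ι f ℚ.+ N
    split = ℚ.≃-trans (ι-+ (n ℕ.+ e ℕ.+ d ℕ.+ f) n) (ℚ.+-cong
      (ℚ.≃-trans (ι-+ (n ℕ.+ e ℕ.+ d) f) (ℚ.+-cong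
        (ℚ.≃-trans (ι-+ (n ℕ.+ e) d) (ℚ.+-cong (ι-+ n e) (ℚ.≃-refl {ι d})))
        (ℚ.≃-refl {ι f})))
      (ℚ.≃-refl {N}))

-- The scalar c/n cancels against the factor n, leaving c times an approximation of lg (n/c).
tracks-term : ∀ c n .{{_ : NonZero c}} .{{_ : NonZero n}} .(1≤n/c : 1ℚᵘ ℚ.≤ ℤ.+ n ℚ./ c) →
              Tracks n (seq ((ℤ.+ c ℚ./ n) ·ℝ lg (ℤ.+ n ℚ./ c) 1≤n/c)) λ m → c ℕ.* ⌊lg⟨ n / c ⟩^ suc m ⌋
tracks-term c@(suc _) n@(suc n′) 1≤n/c = tracks (c ℕ.* 2) λ {m} {i} m≤i →
  ≈-resp (lhs (seq lgn/c (i ℕ.+ c ℕ.* suc i))) (rhs m) (merge 2 m)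
    (≈-* c (seq-later lgn/c {m} {i ℕ.+ c ℕ.* suc i} (ℕ.≤-trans m≤i (ℕ.m≤m+n i _))))
  where
  lgn/c = lg (ℤ.+ n ℚ./ c) 1≤n/c
  c/n : ι n ℚ.* (ℤ.+ c ℚ./ n) ℚ.≃ ι c
  c/n = ℚ.*≡* (trans (ℤ.*-identityʳ _) (trans (ℤ.*-comm (ℤ.+ n) (ℤ.+ c))
    (cong (λ k → ℤ.+ c ℤ.* ℤ.+ suc k) (sym (ℕ.+-identityʳ n′)))))
  lhs : ∀ a → ι c ℚ.* a ℚ.≃ ι n ℚ.* ((ℤ.+ c ℚ./ n) ℚ.* a)
  lhs a = ℚ.≃-trans (ℚ.*-cong (ℚ.≃-sym c/n) (ℚ.≃-refl {a})) (ℚ.*-assoc (ι n) (ℤ.+ c ℚ./ n) a)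
  merge : ∀ k m → ι c ℚ.* (ι k ℚ.* 1/1+ m) ℚ.≃ ι (c ℕ.* k) ℚ.* 1/1+ m
  merge k m = ℚ.≃-trans (ℚ.≃-sym (ℚ.*-assoc (ι c) (ι k) (1/1+ m)))
    (ℚ.*-cong (ℚ.≃-sym (ι-* c k)) (ℚ.≃-refl {1/1+ m}))
  rhs : ∀ m → ι c ℚ.* (ℤ.+ ⌊lg⟨ n / c ⟩^ suc m ⌋ ℚ./ suc m) ℚ.≃
              ι (c ℕ.* ⌊lg⟨ n / c ⟩^ suc m ⌋) ℚ.* 1/1+ m
  rhs m = ℚ.≃-trans (ℚ.*-cong (ℚ.≃-refl {ι c}) (k/1+ k m)) (merge k m)
    where k = ⌊lg⟨ n / c ⟩^ suc m ⌋

-- Grouping equal elements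

module _ {A : Set} (_≟_ : DecidableEquality A) where

  count-∷-≡ : ∀ x S → count _≟_ x (x ∷ S) ≡ suc (count _≟_ x S)
  count-∷-≡ x S = cong length (filter-accept (x ≟_) refl)

  count-∷-≢ : ∀ {x s} S → x ≢ s → count _≟_ x (s ∷ S) ≡ count _≟_ x S
  count-∷-≢ {x} S x≢s = cong length (filter-reject (x ≟_) x≢s)

module _ {c ℓ} (M : CommutativeMonoid c ℓ) where

  open CommutativeMonoid M using (Carrier; _≈_; _∙_; ε; ∙-cong; ∙-congˡ; identityˡ; assoc; reflexive; commutativeSemigroup)
    renaming (refl to ∙-refl; trans to ∙-trans)
  open CommutativeSemigroupProperties commutativeSemigroup using (x∙yz≈y∙xz)

  ⨁ : ∀ {A : Set} → (A → Carrier) → List A → Carrier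
  ⨁ f xs = foldr _∙_ ε (map f xs)

  ⨁-cong : ∀ {A : Set} {f g : A → Carrier} {xs} → All (λ x → f x ≈ g x) xs → ⨁ f xs ≈ ⨁ g xs
  ⨁-cong []         = ∙-refl
  ⨁-cong (fx ∷ fxs) = ∙-cong fx (⨁-cong fxs)

  ⨁-ε : ∀ {A : Set} {f : A → Carrier} → (∀ x → f x ≈ ε) → ∀ xs → ⨁ f xs ≈ ε
  ⨁-ε f≈ε []       = ∙-refl
  ⨁-ε f≈ε (x ∷ xs) = ∙-trans (∙-cong (f≈ε x) (⨁-ε f≈ε xs)) (identityˡ ε)

  -- The k-fold multiple k · g x enters as an arbitrary function h, which makes the lemma apply
  -- both to sums (h k x = k * g x) and to products (h k x = g x ^ k).
  module _ {A : Set} (_≟_ : DecidableEquality A) (g : A → Carrier) (h : ℕ → A → Carrier)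
           (h-zero : ∀ x → h 0 x ≈ ε) (h-suc : ∀ k x → h (suc k) x ≈ g x ∙ h k x) where

    -- Prepending s raises only the count of s, and s has a single term in the repetition-free R.
    ⨁-count-∷ : ∀ {s} S {R} → Unique R → s ∈ R →
                ⨁ (λ x → h (count _≟_ x (s ∷ S)) x) R ≈ g s ∙ ⨁ (λ x → h (count _≟_ x S) x) R
    ⨁-count-∷ {s} S (s≢R ∷ _) (here refl) = ∙-trans
      (∙-cong (∙-trans (reflexive (cong (λ k → h k s) (count-∷-≡ _≟_ s S))) (h-suc _ s))
              (⨁-cong (All.map (λ {x} s≢x → reflexive (cong (λ k → h k x)
                (count-∷-≢ _≟_ S (≢-sym s≢x)))) s≢R)))
      (assoc _ _ _)
    ⨁-count-∷ {s} S {x ∷ _} (x≢R ∷ R!) (there s∈R) = ∙-trans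
      (∙-cong (reflexive (cong (λ k → h k x) (count-∷-≢ _≟_ S (All.lookup x≢R s∈R))))
              (⨁-count-∷ S R! s∈R))
      (x∙yz≈y∙xz _ _ _)

    -- R may list elements that do not occur in S; their terms are h 0 x ≈ ε. This passes between
    -- distinct elements weighted by multiplicity and positions of S.
    ⨁-count : ∀ {R} → Unique R → ∀ {S} → All (_∈ R) S → ⨁ (λ x → h (count _≟_ x S) x) R ≈ ⨁ g S
    ⨁-count {R} R! []           = ⨁-ε h-zero R
    ⨁-count {R} R! (s∈R ∷ S⊆R) = ∙-trans (⨁-count-∷ _ R! s∈R) (∙-congˡ (⨁-count R! S⊆R))

-- Entropy and the product of multiplicities

-- ⌊N lg (n/c)⌋, with the junk value 0 at c = 0.
level : ℕ → ℕ → ℕ → ℕ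
level n zero      N = 0
level n c@(suc _) N = ⌊lg⟨ n / c ⟩^ N ⌋

level-lower : ∀ {n c} N → 1 ℕ.≤ c → c ℕ.≤ n → 2 ^ level n c N ℕ.* c ^ N ℕ.≤ n ^ N
level-lower {c = suc _} N _ c≤n = ⌊lg⌋-lower c≤n N

level-upper : ∀ {n c} N → 1 ℕ.≤ c → c ℕ.≤ n → n ^ N ℕ.≤ 2 ^ suc (level n c N) ℕ.* c ^ N
level-upper {c = suc _} N _ c≤n = ℕ.<⇒≤ (⌊lg⌋-upper c≤n N)

-- The bounds for the single multiplicities are multiplied together, which adds the exponents of 2.
sum-level-lower : ∀ {n} N {cs} → All (λ c → 1 ℕ.≤ c × c ℕ.≤ n) cs →
                  2 ^ sum (map (λ c → level n c N) cs) ℕ.* product cs ^ N ℕ.≤ (n ^ N) ^ length cs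
sum-level-lower N [] = ℕ.≤-reflexive (trans (ℕ.*-identityˡ (1 ^ N)) (ℕ.^-zeroˡ N))
sum-level-lower {n} N {c ∷ cs} ((1≤c , c≤n) ∷ bounds) = begin
  2 ^ (l ℕ.+ k) ℕ.* (c ℕ.* p) ^ N
    ≡⟨ cong₂ ℕ._*_ (ℕ.^-distribˡ-+-* 2 l k) (^-distrib-* c p N) ⟩
  2 ^ l ℕ.* 2 ^ k ℕ.* (c ^ N ℕ.* p ^ N)
    ≡⟨ *-interchange (2 ^ l) (2 ^ k) (c ^ N) (p ^ N) ⟩
  2 ^ l ℕ.* c ^ N ℕ.* (2 ^ k ℕ.* p ^ N)
    ≤⟨ ℕ.*-mono-≤ (level-lower N 1≤c c≤n) (sum-level-lower N bounds) ⟩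
  n ^ N ℕ.* (n ^ N) ^ length cs ∎
  where
  open ℕ.≤-Reasoning
  l = level n c N
  k = sum (map (λ c → level n c N) cs)
  p = product cs

-- Each rounding loses at most a factor 2, hence the additional `length cs` in the exponent, which
-- does not depend on N.
sum-level-upper : ∀ {n} N {cs} → All (λ c → 1 ℕ.≤ c × c ℕ.≤ n) cs →
                  (n ^ N) ^ length cs ℕ.≤ 2 ^ (sum (map (λ c → level n c N) cs) ℕ.+ length cs) ℕ.* product cs ^ N
sum-level-upper N [] = ℕ.≤-reflexive (sym (trans (ℕ.*-identityˡ (1 ^ N)) (ℕ.^-zeroˡ N)))
sum-level-upper {n} N {c ∷ cs} ((1≤c , c≤n) ∷ bounds) = begin
  n ^ N ℕ.* (n ^ N) ^ length cs
    ≤⟨ ℕ.*-mono-≤ (level-upper N 1≤c c≤n) (sum-level-upper N bounds) ⟩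
  2 ^ suc l ℕ.* c ^ N ℕ.* (2 ^ (k ℕ.+ length cs) ℕ.* p ^ N)
    ≡⟨ *-interchange (2 ^ suc l) (c ^ N) (2 ^ (k ℕ.+ length cs)) (p ^ N) ⟩
  2 ^ suc l ℕ.* 2 ^ (k ℕ.+ length cs) ℕ.* (c ^ N ℕ.* p ^ N)
    ≡⟨ cong₂ ℕ._*_ (ℕ.^-distribˡ-+-* 2 (suc l) (k ℕ.+ length cs)) (^-distrib-* c p N) ⟨
  2 ^ (suc l ℕ.+ (k ℕ.+ length cs)) ℕ.* (c ℕ.* p) ^ N
    ≡⟨ cong (λ e → 2 ^ e ℕ.* (c ℕ.* p) ^ N) (trans (sym (ℕ.+-assoc (suc l) k (length cs)))
         (sym (ℕ.+-suc (l ℕ.+ k) (length cs)))) ⟩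
  2 ^ (l ℕ.+ k ℕ.+ suc (length cs)) ℕ.* (c ℕ.* p) ^ N ∎
  where
  open ℕ.≤-Reasoning
  l = level n c N
  k = sum (map (λ c → level n c N) cs)
  p = product cs

tracks-resp : ∀ {n s K L} → (∀ m → K m ≡ L m) → Tracks n s K → Tracks n s L
tracks-resp {n} {s} K≡L (tracks e near) = tracks e λ {m} {i} m≤i →
  subst (λ k → ι n ℚ.* s i ≈[ ι e ℚ.* 1/1+ m ] ι k ℚ.* 1/1+ m) (K≡L m) (near m≤i)

1≤n/c : ∀ c {n} .{{_ : NonZero c}} → c ℕ.≤ n → ℚ.1ℚᵘ ℚ.≤ ℤ.+ n ℚ./ c
1≤n/c (suc c) {n} c≤n = ℚ.*≤* (subst₂ ℤ._≤_ (sym (ℤ.*-identityˡ (ℤ.+ suc c))) (sym (ℤ.*-identityʳ (ℤ.+ n)))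
  (ℤ.+≤+ c≤n))

tracks-sum : ∀ {A : Set} {n} (xs : List A) {f : ∀ {x} → x ∈ xs → ℝ} {K : A → ℕ → ℕ} →
             (∀ {x} (x∈xs : x ∈ xs) → Tracks n (seq (f x∈xs)) (K x)) →
             Tracks n (seq (sumℝ (mapWith∈ xs f))) λ m → sum (map (λ x → K x m) xs)
tracks-sum []       t = tracks-0 _
tracks-sum (x ∷ xs) t = tracks-+ (t (here refl)) (tracks-sum xs (t ∘ there))

module _ {A : Set} (_≟_ : DecidableEquality A) where

  count-pos : ∀ {S x} → x ∈ S → 1 ℕ.≤ count _≟_ x S
  count-pos {S} {x} x∈S = filter-some (x ≟_) x∈S

  count-≤ : ∀ S x → count _≟_ x S ℕ.≤ length S
  count-≤ S x = length-filter (x ≟_) S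

  multiplicities : List A → List ℕ
  multiplicities S = map (λ s → count _≟_ s S) S

  1≤multiplicities≤length : ∀ S → All (λ c → 1 ℕ.≤ c × c ℕ.≤ length S) (multiplicities S)
  1≤multiplicities≤length S = All.map⁺ (All.tabulate λ s∈S → count-pos s∈S , count-≤ S _)

  tracks-entropyTerm : ∀ {S x} (x∈S : x ∈ S) → Tracks (length S) (seq (entropyTerm _≟_ S x∈S))
                         λ m → count _≟_ x S ℕ.* level (length S) (count _≟_ x S) (suc m)
  tracks-entropyTerm {S} {x} x∈S =
    tracks-resp (λ m → cong (count _≟_ x S ℕ.*_) (level-def (count _≟_ x S)))
      (tracks-term (count _≟_ x S) (length S) 1≤)
    where
    instance
      _ = ℕ.>-nonZero (count-pos x∈S)
      _ = ℕ.>-nonZero (ℕ.≤-trans (ℕ.>-nonZero⁻¹ (count _≟_ x S)) (count-≤ S x))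
    1≤ = 1≤n/c (count _≟_ x S) (count-≤ S x)
    level-def : ∀ c {m} .{{_ : NonZero c}} → ⌊lg⟨ length S / c ⟩^ m ⌋ ≡ level (length S) c m
    level-def (suc _) = refl

  -- The entropy sums over distinct symbols x with weight `count x S`; by `⨁-count` this is an
  -- unweighted sum over the positions of S, the form in which levels add up to the logarithm of a
  -- product.
  tracks-H₀ : ∀ S → Tracks (length S) (seq (H₀ _≟_ S))
                λ m → sum (map (λ c → level (length S) c (suc m)) (multiplicities S))
  tracks-H₀ S = tracks-resp regroup
    (tracks-sum (deduplicate _≟_ S) λ x∈ → tracks-entropyTerm (∈-deduplicate⁻ _≟_ S x∈))
    where
    regroup : ∀ m → sum (map (λ x → count _≟_ x S ℕ.* level (length S) (count _≟_ x S) (suc m)) (deduplicate _≟_ S))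
                    ≡ sum (map (λ c → level (length S) c (suc m)) (multiplicities S))
    regroup m = trans
      (⨁-count ℕ.+-0-commutativeMonoid _≟_ (λ x → level (length S) (count _≟_ x S) (suc m))
        (λ k x → k ℕ.* level (length S) (count _≟_ x S) (suc m)) (λ _ → refl) (λ _ _ → refl)
        (deduplicate-! _≟_ S) (All.tabulate (∈-deduplicate⁺ _≟_)))
      (cong sum (map-∘ S))

  multiplicities≢0 : ∀ S → NonZero (product (multiplicities S))
  multiplicities≢0 S = product≢0 (All.map (ℕ.>-nonZero ∘ proj₁) (1≤multiplicities≤length S))

  -- If the level sum K′ of S′ exceeded K + n, then 2^(K+n) P′^N < 2^K′ P′^N ≤ (n^N)^n ≤ 2^(K+n) P^N
  -- ≤ 2^(K+n) P′^N, a contradiction. So K′ ≤ K + n for all N, and `tracks-≤` absorbs the constant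
  -- n.
  H₀-antitone : ∀ {S S′} .{{_ : NonZero (length S)}} → length S ≡ length S′ →
                product (multiplicities S) ℕ.≤ product (multiplicities S′) → H₀ _≟_ S′ ≤ℝ H₀ _≟_ S
  H₀-antitone {S} {S′} len≡ P≤P′ = tracks-≤ (H₀ _≟_ S′) (H₀ _≟_ S) (length S)
    (subst (λ n → Tracks n (seq (H₀ _≟_ S′)) λ m → K′ n (suc m)) (sym len≡) (tracks-H₀ S′))
    (tracks-H₀ S) (λ m → K′≤K+n (suc m))
    where
    open ℕ.≤-Reasoning
    n = length S
    K′ K : ℕ → ℕ → ℕ
    K′ n N = sum (map (λ c → level n c N) (multiplicities S′))
    K  n N = sum (map (λ c → level n c N) (multiplicities S))
    P′ = product (multiplicities S′)
    P  = product (multiplicities S)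

    K′≤K+n : ∀ N → K′ n N ℕ.≤ K n N ℕ.+ n
    K′≤K+n N = ℕ.≮⇒≥ λ K+n<K′ → ℕ.<-irrefl refl (begin-strict
      2 ^ (K n N ℕ.+ n) ℕ.* P′ ^ N
        <⟨ ℕ.*-monoˡ-< (P′ ^ N) {{ℕ.m^n≢0 P′ N {{multiplicities≢0 S′}}}} (ℕ.^-monoʳ-< 2 (s≤s (s≤s z≤n)) K+n<K′) ⟩
      2 ^ K′ n N ℕ.* P′ ^ N
        ≤⟨ sum-level-lower N (All.map (λ (1≤c , c≤) → 1≤c , subst (_ ℕ.≤_) (sym len≡) c≤) (1≤multiplicities≤length S′)) ⟩
      (n ^ N) ^ length (multiplicities S′)
        ≡⟨ cong ((n ^ N) ^_) (trans (length-map _ S′) (trans (sym len≡) (sym (length-map _ S)))) ⟩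
      (n ^ N) ^ length (multiplicities S)
        ≤⟨ sum-level-upper N (1≤multiplicities≤length S) ⟩
      2 ^ (K n N ℕ.+ length (multiplicities S)) ℕ.* P ^ N
        ≡⟨ cong (λ l → 2 ^ (K n N ℕ.+ l) ℕ.* P ^ N) (length-map _ S) ⟩
      2 ^ (K n N ℕ.+ n) ℕ.* P ^ N
        ≤⟨ ℕ.*-monoʳ-≤ (2 ^ (K n N ℕ.+ n)) (ℕ.^-monoˡ-≤ N P≤P′) ⟩
      2 ^ (K n N ℕ.+ n) ℕ.* P′ ^ N ∎)

-- Multiplicative convexity of m ↦ m^m

-- (y+1 - s) (y+1)^s ≤ y^s (y+1), rearranged to avoid truncated subtraction.
bernoulli : ∀ y s → suc y ^ suc s ≤ y ^ s * suc y + s * suc y ^ s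
bernoulli y zero    = ℕ.≤-reflexive (solve 1 (λ y → (con 1 :+ y) :* con 1 := con 1 :* (con 1 :+ y) :+ con 0) refl y)
  where open ℕ-Solver.+-*-Solver
bernoulli y (suc s) = begin
  q + y * q
    ≤⟨ ℕ.+-monoʳ-≤ q (ℕ.*-monoʳ-≤ y (bernoulli y s)) ⟩
  q + y * (y ^ s * suc y + s * suc y ^ s)
    ≡⟨ solve 4 (λ y p r s → (con 1 :+ y) :* r :+ y :* (p :* (con 1 :+ y) :+ s :* r) :=
         y :* p :* (con 1 :+ y) :+ ((con 1 :+ y) :* r :+ s :* (y :* r))) refl y (y ^ s) (suc y ^ s) s ⟩
  y * y ^ s * suc y + (q + s * (y * suc y ^ s))
    ≤⟨ ℕ.+-monoʳ-≤ (y * y ^ s * suc y) (ℕ.+-monoʳ-≤ q (ℕ.*-monoʳ-≤ s (ℕ.*-monoˡ-≤ (suc y ^ s) (ℕ.n≤1+n y)))) ⟩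
  y * y ^ s * suc y + (q + s * q) ∎
  where
  open ℕ.≤-Reasoning
  open ℕ-Solver.+-*-Solver
  q = suc y ^ suc s

-- The quotient numer s / denom s is the multiplicative second difference of m ↦ m^m at m = s+1.
numer denom : ℕ → ℕ
numer s = (2 + s) ^ (2 + s) * s ^ s
denom s = suc s ^ suc s * suc s ^ suc s

-- With z = (s+1)² = y + 1 and y = s (s+2), the claim reads z^(s+1) ≤ (s+2)² y^s. By `bernoulli`,
-- y^s z ≥ (z - s) z^s, so after multiplication by z it is enough that z² ≤ (s+2)² (z - s). Adding
-- t² s q to both sides avoids the subtraction.
denom≤numer : ∀ s → denom s ≤ numer s
denom≤numer s = ℕ.*-cancelʳ-≤ (denom s) (numer s) z (ℕ.+-cancelʳ-≤ (t * t * (s * q)) (denom s * z) (numer s * z) (begin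
  denom s * z + t * t * (s * q)
    ≡⟨ cong (λ p → p * z + t * t * (s * q)) denom≡ ⟩
  z * q * z + t * t * (s * q)
    -- The cubic is the difference (s+2)² (z - s) - z², written as a polynomial in s.
    ≤⟨ ℕ.m≤m+n _ ((s * s * s + 3 * (s * s) + 4 * s + 3) * q) ⟩
  z * q * z + t * t * (s * q) + (s * s * s + 3 * (s * s) + 4 * s + 3) * q
    ≡⟨ solve 2 (λ s q → let y+1 = con 1 :+ s :* (con 2 :+ s); t = con 2 :+ s in
         y+1 :* q :* y+1 :+ t :* t :* (s :* q) :+ (s :* s :* s :+ con 3 :* (s :* s) :+ con 4 :* s :+ con 3) :* q
         := t :* t :* (y+1 :* q)) refl s q ⟩
  t * t * (z * q)
    ≤⟨ ℕ.*-monoʳ-≤ (t * t) (bernoulli y s) ⟩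
  t * t * (y ^ s * z + s * q)
    ≡⟨ solve 5 (λ t p z s q → t :* t :* (p :* z :+ s :* q) := t :* t :* p :* z :+ t :* t :* (s :* q)) refl t (y ^ s) z s q ⟩
  t * t * y ^ s * z + t * t * (s * q)
    ≡⟨ cong (λ p → p * z + t * t * (s * q)) numer≡ ⟨
  numer s * z + t * t * (s * q) ∎))
  where
  open ℕ.≤-Reasoning
  open ℕ-Solver.+-*-Solver
  t = 2 + s
  y = s * t
  z = suc y
  q = z ^ s
  denom≡ : denom s ≡ z * q
  denom≡ = trans (sym (^-distrib-* (suc s) (suc s) (suc s)))
    (cong (_^ suc s) (solve 1 (λ s → (con 1 :+ s) :* (con 1 :+ s) := con 1 :+ s :* (con 2 :+ s)) refl s))
  numer≡ : numer s ≡ t * t * y ^ s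
  numer≡ = trans (solve 3 (λ t p r → t :* (t :* p) :* r := t :* t :* (r :* p)) refl t (t ^ s) (s ^ s))
    (cong (t * t *_) (sym (^-distrib-* s t s)))

∏ : ℕ → (ℕ → ℕ) → ℕ
∏ zero    f = 1
∏ (suc n) f = ∏ n f * f n

∏-cong : ∀ n {f g} → (∀ i → f i ≡ g i) → ∏ n f ≡ ∏ n g
∏-cong zero    f≡g = refl
∏-cong (suc n) f≡g = cong₂ _*_ (∏-cong n f≡g) (f≡g n)

∏-mono : ∀ n {f g} → (∀ i → f i ≤ g i) → ∏ n f ≤ ∏ n g
∏-mono zero    f≤g = ℕ.≤-refl
∏-mono (suc n) f≤g = ℕ.*-mono-≤ (∏-mono n f≤g) (f≤g n)

∏-* : ∀ n f g → ∏ n (λ i → f i * g i) ≡ ∏ n f * ∏ n g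
∏-* zero    f g = refl
∏-* (suc n) f g = trans (cong (_* (f n * g n)) (∏-* n f g)) (*-interchange (∏ n f) (∏ n g) (f n) (g n))

∏-^+ : ∀ n (f k l : ℕ → ℕ) → ∏ n (λ i → f i ^ (k i + l i)) ≡ ∏ n (λ i → f i ^ k i) * ∏ n (λ i → f i ^ l i)
∏-^+ n f k l = trans (∏-cong n (λ i → ℕ.^-distribˡ-+-* (f i) (k i) (l i))) (∏-* n _ _)

∏≢0 : ∀ n {f} → (∀ i → NonZero (f i)) → NonZero (∏ n f)
∏≢0 zero    f≢0 = _
∏≢0 (suc n) {f} f≢0 = ℕ.m*n≢0 (∏ n f) (f n) {{∏≢0 n f≢0}} {{f≢0 n}}

∏-extend : ∀ {f m n} → m ≤ n → (∀ {i} → m ≤ i → f i ≡ 1) → ∏ n f ≡ ∏ m f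
∏-extend {n = zero}  z≤n f≡1 = refl
∏-extend {f} {m} {suc n} m≤n f≡1 with m ℕ.≟ suc n
... | yes refl = refl
... | no m≢1+n = trans (cong₂ _*_ (∏-extend m≤n′ f≡1) (f≡1 m≤n′)) (ℕ.*-identityʳ (∏ m f))
  where m≤n′ = ℕ.≤-pred (ℕ.≤∧≢⇒< m≤n m≢1+n)

-- With r m = (m+1)^(m+1) / m^m, the quotient `numer s / denom s` is r (s+1) / r s, so the product
-- over s < m collapses to r m / r 0, and r 0 = 1.
∏-telescope : ∀ m → suc m ^ suc m * ∏ m denom ≡ m ^ m * ∏ m numer
∏-telescope zero    = refl
∏-telescope (suc m) = begin
  z * (∏ m denom * (x * x))    ≡⟨ solve 3 (λ z B x → z :* (B :* (x :* x)) := z :* x :* (x :* B)) refl z (∏ m denom) x ⟩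
  z * x * (x * ∏ m denom)      ≡⟨ cong (z * x *_) (∏-telescope m) ⟩
  z * x * (y * ∏ m numer)      ≡⟨ solve 4 (λ z x y A → z :* x :* (y :* A) := x :* (A :* (z :* y))) refl z x y (∏ m numer) ⟩
  x * (∏ m numer * (z * y))    ∎
  where
  open ≡-Reasoning
  open ℕ-Solver.+-*-Solver
  x = suc m ^ suc m
  y = m ^ m
  z = (2 + m) ^ (2 + m)

∏-^∸-suc : ∀ f {n m} → n ≤ m → ∏ n (λ s → f s ^ (m ∸ s)) ≡ ∏ n (λ s → f s ^ (m ∸ suc s)) * ∏ n f
∏-^∸-suc f {zero}  n<m = refl
∏-^∸-suc f {suc n} {m} n<m = begin
  ∏ n (λ s → f s ^ (m ∸ s)) * f n ^ (m ∸ n)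
    ≡⟨ cong₂ _*_ (∏-^∸-suc f (ℕ.<⇒≤ n<m)) (cong (f n ^_) (ℕ.+-∸-assoc 1 n<m)) ⟩
  ∏ n (λ s → f s ^ (m ∸ suc s)) * ∏ n f * (f n * f n ^ (m ∸ suc n))
    ≡⟨ solve 4 (λ p q r s → p :* q :* (r :* s) := p :* s :* (q :* r)) refl
         (∏ n (λ s → f s ^ (m ∸ suc s))) (∏ n f) (f n) (f n ^ (m ∸ suc n)) ⟩
  ∏ n (λ s → f s ^ (m ∸ suc s)) * f n ^ (m ∸ suc n) * (∏ n f * f n) ∎
  where
  open ≡-Reasoning
  open ℕ-Solver.+-*-Solver

-- A multiplicative Taylor formula: m^m is the product of (`numer s / denom s`)^(m-1-s) over s < m.
-- Passing to m + 1 raises every exponent by one, which contributes exactly the ratio computed by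
-- `∏-telescope`.
m^m-diagonal : ∀ m → m ^ m * ∏ m (λ s → denom s ^ (m ∸ suc s)) ≡ ∏ m (λ s → numer s ^ (m ∸ suc s))
m^m-diagonal zero    = refl
m^m-diagonal (suc m) = begin
  x * (∏ m (λ s → denom s ^ (m ∸ s)) * denom m ^ (m ∸ m))
    ≡⟨ cong (x *_) (drop denom) ⟩
  x * (∏ m (λ s → denom s ^ (m ∸ suc s)) * ∏ m denom)
    ≡⟨ solve 3 (λ x P B → x :* (P :* B) := P :* (x :* B)) refl x B′ (∏ m denom) ⟩
  B′ * (x * ∏ m denom)
    ≡⟨ cong (B′ *_) (∏-telescope m) ⟩
  B′ * (m ^ m * ∏ m numer)
    ≡⟨ solve 3 (λ P y A → P :* (y :* A) := (y :* P) :* A) refl B′ (m ^ m) (∏ m numer) ⟩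
  m ^ m * B′ * ∏ m numer
    ≡⟨ cong (_* ∏ m numer) (m^m-diagonal m) ⟩
  ∏ m (λ s → numer s ^ (m ∸ suc s)) * ∏ m numer
    ≡⟨ drop numer ⟨
  ∏ m (λ s → numer s ^ (m ∸ s)) * numer m ^ (m ∸ m) ∎
  where
  open ≡-Reasoning
  open ℕ-Solver.+-*-Solver
  x = suc m ^ suc m
  B′ = ∏ m (λ s → denom s ^ (m ∸ suc s))
  drop : ∀ f → ∏ m (λ s → f s ^ (m ∸ s)) * f m ^ (m ∸ m) ≡ ∏ m (λ s → f s ^ (m ∸ suc s)) * ∏ m f
  drop f = trans (cong (λ k → ∏ m (λ s → f s ^ (m ∸ s)) * f m ^ k) (ℕ.n∸n≡0 m))
    (trans (ℕ.*-identityʳ _) (∏-^∸-suc f {m} ℕ.≤-refl))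

-- For s ≥ m the truncated exponents vanish, so one index range s < n serves all m ≤ n at once.
m^m-factor : ∀ {m n} → m ≤ n → m ^ m * ∏ n (λ s → denom s ^ (m ∸ suc s)) ≡ ∏ n (λ s → numer s ^ (m ∸ suc s))
m^m-factor {m} {n} m≤n = begin
  m ^ m * ∏ n (λ s → denom s ^ (m ∸ suc s))  ≡⟨ cong (m ^ m *_) (shrink denom) ⟩
  m ^ m * ∏ m (λ s → denom s ^ (m ∸ suc s))  ≡⟨ m^m-diagonal m ⟩
  ∏ m (λ s → numer s ^ (m ∸ suc s))          ≡⟨ shrink numer ⟨
  ∏ n (λ s → numer s ^ (m ∸ suc s))          ∎
  where
  open ≡-Reasoning
  shrink : ∀ f → ∏ n (λ s → f s ^ (m ∸ suc s)) ≡ ∏ m (λ s → f s ^ (m ∸ suc s))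
  shrink f = ∏-extend m≤n λ {i} m≤i → cong (f i ^_) (ℕ.m≤n⇒m∸n≡0 (ℕ.m≤n⇒m≤1+n m≤i))

-- Comparing products of self-powers through excesses

excess : ℕ → List ℕ → ℕ
excess t ms = sum (map (_∸ t) ms)

selfPowers : List ℕ → ℕ
selfPowers ms = product (map (λ m → m ^ m) ms)

selfPowers-factor : ∀ {n ms} → All (_≤ n) ms → selfPowers ms * ∏ n (λ s → denom s ^ excess (suc s) ms) ≡
                    ∏ n (λ s → numer s ^ excess (suc s) ms)
selfPowers-factor {n} []                    = trans (ℕ.*-identityˡ _) (trans (one denom) (sym (one numer)))
  where
  one : ∀ f → ∏ n (λ s → f s ^ 0) ≡ 1
  one f = ∏-extend {n = n} z≤n (λ _ → refl)
selfPowers-factor {n} {m ∷ ms} (m≤n ∷ ms≤n) = begin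
  m ^ m * selfPowers ms * ∏ n (λ s → denom s ^ (m ∸ suc s + excess (suc s) ms))
    ≡⟨ cong (m ^ m * selfPowers ms *_) (∏-^+ n denom (λ s → m ∸ suc s) (λ s → excess (suc s) ms)) ⟩
  m ^ m * selfPowers ms * (∏ n (λ s → denom s ^ (m ∸ suc s)) * ∏ n (λ s → denom s ^ excess (suc s) ms))
    ≡⟨ *-interchange (m ^ m) (selfPowers ms) _ _ ⟩
  m ^ m * ∏ n (λ s → denom s ^ (m ∸ suc s)) * (selfPowers ms * ∏ n (λ s → denom s ^ excess (suc s) ms))
    ≡⟨ cong₂ _*_ (m^m-factor m≤n) (selfPowers-factor ms≤n) ⟩
  ∏ n (λ s → numer s ^ (m ∸ suc s)) * ∏ n (λ s → numer s ^ excess (suc s) ms)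
    ≡⟨ ∏-^+ n numer (λ s → m ∸ suc s) (λ s → excess (suc s) ms) ⟨
  ∏ n (λ s → numer s ^ (m ∸ suc s + excess (suc s) ms)) ∎
  where open ≡-Reasoning

-- Raising the exponents of factors `numer s / denom s` ≥ 1 does not decrease a product. To avoid
-- quotients both sides are multiplied by B′, whose exponents split as h′ = h + d: the part with h
-- is handled by `selfPowers-factor`, the part with d by `denom≤numer`.
selfPowers-mono : ∀ {n ms ms′} → All (_≤ n) ms → All (_≤ n) ms′ →
                  (∀ t → excess t ms ≤ excess t ms′) → selfPowers ms ≤ selfPowers ms′
selfPowers-mono {n} {ms} {ms′} ms≤n ms′≤n h≤h′ = ℕ.*-cancelʳ-≤ _ _ B′ {{B′≢0}} (begin
  selfPowers ms * B′
    ≡⟨ cong (selfPowers ms *_) (split denom) ⟩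
  selfPowers ms * (∏ n (λ s → denom s ^ h s) * ∏ n (λ s → denom s ^ d s))
    ≡⟨ ℕ.*-assoc (selfPowers ms) _ _ ⟨
  selfPowers ms * ∏ n (λ s → denom s ^ h s) * ∏ n (λ s → denom s ^ d s)
    ≡⟨ cong (_* ∏ n (λ s → denom s ^ d s)) (selfPowers-factor ms≤n) ⟩
  ∏ n (λ s → numer s ^ h s) * ∏ n (λ s → denom s ^ d s)
    ≤⟨ ℕ.*-monoʳ-≤ (∏ n (λ s → numer s ^ h s)) (∏-mono n (λ s → ℕ.^-monoˡ-≤ (d s) (denom≤numer s))) ⟩
  ∏ n (λ s → numer s ^ h s) * ∏ n (λ s → numer s ^ d s)
    ≡⟨ split numer ⟨
  ∏ n (λ s → numer s ^ h′ s)
    ≡⟨ selfPowers-factor ms′≤n ⟨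
  selfPowers ms′ * B′ ∎)
  where
  open ℕ.≤-Reasoning
  h h′ d : ℕ → ℕ
  h s = excess (suc s) ms
  h′ s = excess (suc s) ms′
  d s = h′ s ∸ h s
  B′ = ∏ n (λ s → denom s ^ h′ s)
  B′≢0 : NonZero B′
  B′≢0 = ∏≢0 n λ s → ℕ.m^n≢0 (denom s) (h′ s) {{ℕ.m*n≢0 _ _ {{ℕ.m^n≢0 (suc s) (suc s)}} {{ℕ.m^n≢0 (suc s) (suc s)}}}}
  split : ∀ f → ∏ n (λ s → f s ^ h′ s) ≡ ∏ n (λ s → f s ^ h s) * ∏ n (λ s → f s ^ d s)
  split f = trans (∏-cong n λ s → cong (f s ^_) (sym (ℕ.m+[n∸m]≡n (h≤h′ (suc s))))) (∏-^+ n f h d)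

-- Counting labels column by column

∑ : (A → ℕ) → List A → ℕ
∑ f xs = sum (map f xs)

∑-mono : ∀ {f g : A → ℕ} {xs} → All (λ x → f x ≤ g x) xs → ∑ f xs ≤ ∑ g xs
∑-mono []             = z≤n
∑-mono (fx≤gx ∷ f≤g) = ℕ.+-mono-≤ fx≤gx (∑-mono f≤g)

∑-+ : ∀ (f g : A → ℕ) xs → ∑ (λ x → f x + g x) xs ≡ ∑ f xs + ∑ g xs
∑-+ f g []       = refl
∑-+ f g (x ∷ xs) = trans (cong (f x + g x +_) (∑-+ f g xs)) (+-interchange (f x) (g x) (∑ f xs) (∑ g xs))

∑-const : ∀ k (xs : List A) → ∑ (λ _ → k) xs ≡ length xs * k
∑-const k []       = refl
∑-const k (x ∷ xs) = cong (k +_) (∑-const k xs)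

∑-comm : ∀ (f : A → B → ℕ) xs ys → ∑ (λ x → ∑ (f x) ys) xs ≡ ∑ (λ y → ∑ (λ x → f x y) xs) ys
∑-comm f []       ys = sym (trans (∑-const 0 ys) (ℕ.*-zeroʳ (length ys)))
∑-comm f (x ∷ xs) ys = trans (cong (∑ (f x) ys +_) (∑-comm f xs ys))
  (sym (∑-+ (f x) (λ y → ∑ (λ x → f x y) xs) ys))

∑-concatMap : ∀ (f : B → ℕ) (g : A → List B) xs → ∑ f (concatMap g xs) ≡ ∑ (λ x → ∑ f (g x)) xs
∑-concatMap f g []       = refl
∑-concatMap f g (x ∷ xs) = trans (cong sum (map-++ f (g x) (concatMap g xs)))
  (trans (sum-++ (map f (g x)) _) (cong (∑ f (g x) +_) (∑-concatMap f g xs)))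

∑-map : ∀ (f : B → ℕ) (g : A → B) xs → ∑ f (map g xs) ≡ ∑ (f ∘ g) xs
∑-map f g xs = cong sum (sym (map-∘ xs))

∑-take : ∀ (f : A → ℕ) k xs → ∑ f (take k xs) ≤ ∑ f xs
∑-take f zero    xs       = z≤n
∑-take f (suc k) []       = z≤n
∑-take f (suc k) (x ∷ xs) = ℕ.+-monoʳ-≤ (f x) (∑-take f k xs)

∑-applyUpTo-mono : ∀ (f : A → ℕ) g {m n} → m ≤ n → ∑ f (applyUpTo g m) ≤ ∑ f (applyUpTo g n)
∑-applyUpTo-mono f g z≤n       = z≤n
∑-applyUpTo-mono f g (s≤s m≤n) = ℕ.+-monoʳ-≤ (f (g 0)) (∑-applyUpTo-mono f (g ∘ suc) m≤n)

module _ (_≟_ : DecidableEquality A) where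

  count-∷ : ∀ x s S → count _≟_ x (s ∷ S) ≡ count _≟_ x (s ∷ []) + count _≟_ x S
  count-∷ x s S with x ≟ s
  ... | yes _ = refl
  ... | no _  = refl

  count-singleton-sym : ∀ x s → count _≟_ x (s ∷ []) ≡ count _≟_ s (x ∷ [])
  count-singleton-sym x s with x ≟ s | s ≟ x
  ... | yes _   | yes _   = refl
  ... | no _    | no _    = refl
  ... | yes x≡s | no s≢x  = contradiction (sym x≡s) s≢x
  ... | no x≢s  | yes s≡x = contradiction (sym s≡x) x≢s

  count-as-∑ : ∀ x S → count _≟_ x S ≡ ∑ (λ s → count _≟_ x (s ∷ [])) S
  count-as-∑ x []      = refl
  count-as-∑ x (s ∷ S) = trans (count-∷ x s S) (cong (count _≟_ x (s ∷ []) +_) (count-as-∑ x S))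

  -- Both sides count the pairs of positions, one in xs and one in ys, that hold equal entries.
  ∑-count-comm : ∀ xs ys → ∑ (λ x → count _≟_ x ys) xs ≡ ∑ (λ y → count _≟_ y xs) ys
  ∑-count-comm xs ys = begin
    ∑ (λ x → count _≟_ x ys) xs
      ≡⟨ cong sum (map-cong (λ x → count-as-∑ x ys) xs) ⟩
    ∑ (λ x → ∑ (λ y → count _≟_ x (y ∷ [])) ys) xs
      ≡⟨ ∑-comm (λ x y → count _≟_ x (y ∷ [])) xs ys ⟩
    ∑ (λ y → ∑ (λ x → count _≟_ x (y ∷ [])) xs) ys
      ≡⟨ cong sum (map-cong (λ y → trans (cong sum (map-cong (λ x → count-singleton-sym x y) xs))
           (sym (count-as-∑ y xs))) ys) ⟩
    ∑ (λ y → count _≟_ y xs) ys ∎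
    where open ≡-Reasoning

  count-∉ : ∀ {x S} → All (x ≢_) S → count _≟_ x S ≡ 0
  count-∉ []            = refl
  count-∉ (x≢s ∷ x≢S) = trans (count-∷-≢ _≟_ _ x≢s) (count-∉ x≢S)

  count-unique : ∀ {S} → Unique S → ∀ x → count _≟_ x S ≤ 1
  count-unique []                x = z≤n
  count-unique {s ∷ S} (s≢S ∷ S!) x with x ≟ s
  ... | yes refl = s≤s (ℕ.≤-reflexive (count-∉ s≢S))
  ... | no _     = count-unique S! x

unique-map : ∀ {f : A → B} {xs} → (∀ {x y} → x ∈ xs → y ∈ xs → f x ≡ f y → x ≡ y) → Unique xs → Unique (map f xs)
unique-map inj []            = []
unique-map inj (x≢xs ∷ xs!) =
  All.map⁺ (All.tabulate λ y∈xs fx≡fy → All.lookup x≢xs y∈xs (inj (here refl) (there y∈xs) fx≡fy))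
  ∷ unique-map (λ x∈ y∈ → inj (there x∈) (there y∈)) xs!

all-take : ∀ {P : A → Set} k xs → (∀ i → toℕ i < k → P (lookup xs i)) → All P (take k xs)
all-take zero    xs       p = []
all-take (suc k) []       p = []
all-take (suc k) (x ∷ xs) p = p Fin.zero (s≤s z≤n) ∷ all-take k xs λ i i<k → p (Fin.suc i) (s≤s i<k)

module _ {N : A → ℕ} where

  Descending : List A → Set
  Descending = AllPairs (λ u v → N v ≤ N u)

  -- Moving the window of k entries one place to the left replaces each entry by one of at least the
  -- same weight.
  ∑-take-tail : ∀ k {w ws} → Descending (w ∷ ws) → ∑ N (take k ws) ≤ ∑ N (take k (w ∷ ws))
  ∑-take-tail zero    _ = z≤n
  ∑-take-tail (suc k) {ws = []}     _ = z≤n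
  ∑-take-tail (suc k) {ws = v ∷ ws} ((v≤w ∷ _) ∷ ws↘) = ℕ.+-mono-≤ v≤w (∑-take-tail k ws↘)

  -- F is the indicator of a selection of at most k entries. A skipped head is paid for by
  -- `∑-take-tail`; a selected head uses up one of the k places.
  ∑-weighted-≤-top : ∀ {F : A → ℕ} k {ws} → Descending ws → All (λ w → F w ≤ 1) ws → ∑ F ws ≤ k →
                     ∑ (λ w → N w * F w) ws ≤ ∑ N (take k ws)
  ∑-weighted-≤-top k []                    _             _    = z≤n
  ∑-weighted-≤-top {F} k {w ∷ ws} ↘@(_ ∷ ws↘) (Fw≤1 ∷ F≤1) ∑≤k with F w
  ... | 0 = begin
    N w * 0 + ∑ (λ w → N w * F w) ws  ≡⟨ cong (_+ ∑ (λ w → N w * F w) ws) (ℕ.*-zeroʳ (N w)) ⟩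
    ∑ (λ w → N w * F w) ws            ≤⟨ ∑-weighted-≤-top k ws↘ F≤1 ∑≤k ⟩
    ∑ N (take k ws)                   ≤⟨ ∑-take-tail k ↘ ⟩
    ∑ N (take k (w ∷ ws))             ∎
    where open ℕ.≤-Reasoning
  ∑-weighted-≤-top {F} (suc k) {w ∷ ws} (_ ∷ ws↘) (_ ∷ F≤1) (s≤s ∑≤k) | 1 =
    ℕ.+-mono-≤ (ℕ.≤-reflexive (ℕ.*-identityʳ (N w))) (∑-weighted-≤-top k ws↘ F≤1 ∑≤k)
  ∑-weighted-≤-top k _ (s≤s () ∷ _) _ | suc (suc _)

  -- Labels within a column are distinct, so each element of J selects at most one entry of ws, and
  -- at most `length J` entries are selected in all.
  column-≤ : ∀ {lab : A → ℕ} {ws J} → Descending ws → Unique (map lab ws) → Unique J →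
             ∑ (λ w → N w * count ℕ._≟_ (lab w) J) ws ≤ ∑ N (take (length J) ws)
  column-≤ {lab} {ws} {J} ws↘ lab! J! = ∑-weighted-≤-top (length J) ws↘
    (All.tabulate λ {w} _ → count-unique ℕ._≟_ J! (lab w)) (begin
      ∑ (λ w → count ℕ._≟_ (lab w) J) ws     ≡⟨ ∑-map (λ x → count ℕ._≟_ x J) lab ws ⟨
      ∑ (λ x → count ℕ._≟_ x J) (map lab ws) ≡⟨ ∑-count-comm ℕ._≟_ (map lab ws) J ⟩
      ∑ (λ x → count ℕ._≟_ x (map lab ws)) J ≤⟨ ∑-mono (All.universal (count-unique ℕ._≟_ lab!) J) ⟩
      ∑ (λ _ → 1) J                          ≡⟨ ∑-const 1 J ⟩
      length J * 1                           ≡⟨ ℕ.*-identityʳ (length J) ⟩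
      length J                               ∎)
    where open ℕ.≤-Reasoning

  -- The first k entries carry labels among 1, ..., k, so each of them is counted at least once on
  -- the right.
  column-≥ : ∀ {lab : A → ℕ} {ws} → (∀ i → lab (lookup ws i) ≡ suc (toℕ i)) → ∀ k →
             ∑ N (take k ws) ≤ ∑ (λ w → N w * count ℕ._≟_ (lab w) (applyUpTo suc k)) ws
  column-≥ {lab} {ws} ranked k = begin
    ∑ N (take k ws)                    ≡⟨ cong sum (map-cong (ℕ.*-identityʳ ∘ N) (take k ws)) ⟨
    ∑ (λ w → N w * 1) (take k ws)      ≤⟨ ∑-mono (All.map (λ {w} → ℕ.*-monoʳ-≤ (N w)) (all-take k ws label≤k)) ⟩
    ∑ (λ w → N w * F w) (take k ws)    ≤⟨ ∑-take _ k ws ⟩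
    ∑ (λ w → N w * F w) ws             ∎
    where
    open ℕ.≤-Reasoning
    F : A → ℕ
    F w = count ℕ._≟_ (lab w) (applyUpTo suc k)
    label≤k : ∀ i → toℕ i < k → 1 ≤ F (lookup ws i)
    label≤k i i<k = subst (λ x → 1 ≤ count ℕ._≟_ x (applyUpTo suc k)) (sym (ranked i))
      (filter-some (suc (toℕ i) ℕ.≟_) (∈-applyUpTo⁺ suc i<k))

-- Entries with c x ≤ t vanish in the truncated sum; each of the others regains its full c x from
-- one copy of t.
∑-filter-excess : ∀ (c : A → ℕ) t xs →
  ∑ (λ x → c x ∸ t) xs + length (filter (λ x → t ℕ.<? c x) xs) * t ≡ ∑ c (filter (λ x → t ℕ.<? c x) xs)
∑-filter-excess c t []       = refl
∑-filter-excess c t (x ∷ xs) with t ℕ.<? c x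
... | yes t<c rewrite filter-accept (λ x → t ℕ.<? c x) {x} {xs} t<c =
  trans (+-interchange (c x ∸ t) (∑ (λ x → c x ∸ t) xs) t _)
    (cong₂ _+_ (ℕ.m∸n+n≡m (ℕ.<⇒≤ t<c)) (∑-filter-excess c t xs))
... | no t≮c rewrite filter-reject (λ x → t ℕ.<? c x) {x} {xs} t≮c =
  trans (cong (λ k → k + ∑ (λ x → c x ∸ t) xs + length (filter (λ x → t ℕ.<? c x) xs) * t)
           (ℕ.m≤n⇒m∸n≡0 (ℕ.≮⇒≥ t≮c)))
    (∑-filter-excess c t xs)

∑-≤-excess : ∀ (c : A → ℕ) t xs → ∑ c xs ≤ ∑ (λ x → c x ∸ t) xs + length xs * t
∑-≤-excess c t xs = begin
  ∑ c xs                                  ≤⟨ ∑-mono (All.universal (λ x → ℕ.≤-trans (ℕ.m≤n+m∸n (c x) t) (ℕ.≤-reflexive (ℕ.+-comm t (c x ∸ t)))) xs) ⟩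
  ∑ (λ x → (c x ∸ t) + t) xs              ≡⟨ ∑-+ (λ x → c x ∸ t) (λ _ → t) xs ⟩
  ∑ (λ x → c x ∸ t) xs + ∑ (λ _ → t) xs   ≡⟨ cong (∑ (λ x → c x ∸ t) xs +_) (∑-const t xs) ⟩
  ∑ (λ x → c x ∸ t) xs + length xs * t    ∎
  where open ℕ.≤-Reasoning

-- The excess of c over t only involves the set of x with c x > t, so sums of c over sets suffice.
excess-mono : ∀ {c c* : ℕ → ℕ} → (∀ {J} → Unique J → ∑ c J ≤ ∑ c* (applyUpTo suc (length J))) →
              ∀ n t → excess t (map c (applyUpTo suc n)) ≤ excess t (map c* (applyUpTo suc n))
excess-mono {c} {c*} dominated n t = begin
  excess t (map c R)                  ≡⟨ ∑-map (_∸ t) c R ⟩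
  ∑ (λ x → c x ∸ t) R                 ≤⟨ ℕ.+-cancelʳ-≤ (length J * t) _ _ shifted ⟩
  ∑ (λ x → c* x ∸ t) R                ≡⟨ ∑-map (_∸ t) c* R ⟨
  excess t (map c* R)                 ∎
  where
  open ℕ.≤-Reasoning
  R J top : List ℕ
  R = applyUpTo suc n
  J = filter (λ x → t ℕ.<? c x) R
  top = applyUpTo suc (length J)
  J! : Unique J
  J! = Unique.filter⁺ _ (Unique.applyUpTo⁺₁ suc n λ i<j _ → ℕ.<⇒≢ i<j ∘ ℕ.suc-injective)
  length-J : length J ≤ n
  length-J = subst (length J ≤_) (length-applyUpTo suc n) (length-filter _ R)
  shifted : ∑ (λ x → c x ∸ t) R + length J * t ≤ ∑ (λ x → c* x ∸ t) R + length J * t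
  shifted = begin
    ∑ (λ x → c x ∸ t) R + length J * t      ≡⟨ ∑-filter-excess c t R ⟩
    ∑ c J                                   ≤⟨ dominated J! ⟩
    ∑ c* top                                ≤⟨ ∑-≤-excess c* t top ⟩
    ∑ (λ x → c* x ∸ t) top + length top * t ≡⟨ cong (λ k → ∑ (λ x → c* x ∸ t) top + k * t) (length-applyUpTo suc (length J)) ⟩
    ∑ (λ x → c* x ∸ t) top + length J * t   ≤⟨ ℕ.+-monoˡ-≤ (length J * t) (∑-applyUpTo-mono _ suc length-J) ⟩
    ∑ (λ x → c* x ∸ t) R + length J * t     ∎

-- Bigrams grouped by their second symbol

module _ (_≟_ : DecidableEquality A) (P : List (A × A)) where

  _≟²_ : DecidableEquality (A × A)
  _≟²_ = ×-≡-dec _≟_ _≟_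

  -- The content of `IsBigramOrdered`, with an arbitrary list P of pairs in place of the bigrams.
  Ranking : (A → A → ℕ) → Set
  Ranking lab = ∀ w′ → ∃ λ ws → Unique ws × (∀ w → w ∈ ws ⇔ (w , w′) ∈ P)
    × AllPairs (λ u v → count _≟²_ (v , w′) P ≤ count _≟²_ (u , w′) P) ws
    × (∀ i → lab (lookup ws i) w′ ≡ suc (toℕ i))

  module _ (col : A → List A) (col! : ∀ w′ → Unique (col w′)) (col∈ : ∀ {w w′} → (w , w′) ∈ P → w ∈ col w′) where

    columns : List A
    columns = deduplicate _≟_ (map proj₂ P)

    -- A repetition-free list that covers P, arranged by columns; it plays the role of R in
    -- `⨁-count`.
    cells : List (A × A)
    cells = concatMap (λ w′ → map (_, w′) (col w′)) columns

    cells! : Unique cells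
    cells! = Unique.concat⁺
      (All.map⁺ (All.tabulate λ {w′} _ → Unique.map⁺ ,-injectiveˡ (col! w′)))
      (AllPairs.map⁺ (AllPairs.map disjoint (deduplicate-! _≟_ (map proj₂ P))))
      where
      disjoint : ∀ {v′ w′} → v′ ≢ w′ → ∀ {p} → p ∈ map (_, v′) (col v′) × p ∈ map (_, w′) (col w′) → _
      disjoint v′≢w′ (p∈ , q∈) with ∈-map⁻ _ p∈ | ∈-map⁻ _ q∈
      ... | _ , _ , p≡ | _ , _ , q≡ = v′≢w′ (,-injectiveʳ (trans (sym p≡) q≡))

    ∈-cells : ∀ {p} → p ∈ P → p ∈ cells
    ∈-cells {w , w′} p∈ = ∈-concatMap⁺ (λ w′ → map (_, w′) (col w′))
      (lose (∈-deduplicate⁺ _≟_ (∈-map⁺ proj₂ p∈)) (∈-map⁺ (_, w′) (col∈ p∈)))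

    ∑-by-column : ∀ (F : A × A → ℕ) →
      ∑ F P ≡ ∑ (λ w′ → ∑ (λ w → count _≟²_ (w , w′) P * F (w , w′)) (col w′)) columns
    ∑-by-column F = begin
      ∑ F P
        ≡⟨ ⨁-count ℕ.+-0-commutativeMonoid _≟²_ F (λ k p → k * F p) (λ _ → refl) (λ _ _ → refl)
             cells! (All.tabulate ∈-cells) ⟨
      ∑ (λ p → count _≟²_ p P * F p) cells
        ≡⟨ ∑-concatMap (λ p → count _≟²_ p P * F p) (λ w′ → map (_, w′) (col w′)) columns ⟩
      ∑ (λ w′ → ∑ (λ p → count _≟²_ p P * F p) (map (_, w′) (col w′))) columns
        ≡⟨ cong sum (map-cong (λ w′ → ∑-map (λ p → count _≟²_ p P * F p) (_, w′) (col w′)) columns) ⟩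
      ∑ (λ w′ → ∑ (λ w → count _≟²_ (w , w′) P * F (w , w′)) (col w′)) columns ∎
      where open ≡-Reasoning

  -- Both totals are split along the same columns, each listed in the descending order supplied by
  -- the ranking. Within a column, the sum of the `length J` largest bigram counts separates the two
  -- sides.
  ranking-dominates : ∀ {lab lab* : A → A → ℕ} → Ranking lab* →
    (∀ {v w w′} → (v , w′) ∈ P → (w , w′) ∈ P → lab v w′ ≡ lab w w′ → v ≡ w) →
    ∀ {J} → Unique J →
    ∑ (λ x → count ℕ._≟_ x (map (uncurry lab) P)) J ≤
    ∑ (λ x → count ℕ._≟_ x (map (uncurry lab*) P)) (applyUpTo suc (length J))
  ranking-dominates {lab} {lab*} ranking inj {J} J! = begin
    ∑ (λ x → count ℕ._≟_ x (map (uncurry lab) P)) J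
      ≡⟨ by-column lab J ⟩
    ∑ (λ w′ → ∑ (λ w → count _≟²_ (w , w′) P * count ℕ._≟_ (lab w w′) J) (col w′)) (columns col col! col∈)
      ≤⟨ ∑-mono (All.universal column (columns col col! col∈)) ⟩
    ∑ (λ w′ → ∑ (λ w → count _≟²_ (w , w′) P * count ℕ._≟_ (lab* w w′) top) (col w′)) (columns col col! col∈)
      ≡⟨ by-column lab* top ⟨
    ∑ (λ x → count ℕ._≟_ x (map (uncurry lab*) P)) top ∎
    where
    open ℕ.≤-Reasoning
    top = applyUpTo suc (length J)
    col : A → List A
    col w′ = proj₁ (ranking w′)
    col! : ∀ w′ → Unique (col w′)
    col! w′ = proj₁ (proj₂ (ranking w′))
    col⇔ : ∀ {w w′} → w ∈ col w′ ⇔ (w , w′) ∈ P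
    col⇔ {w} {w′} = proj₁ (proj₂ (proj₂ (ranking w′))) w
    col∈ : ∀ {w w′} → (w , w′) ∈ P → w ∈ col w′
    col∈ = Equivalence.from col⇔
    by-column : ∀ (l : A → A → ℕ) K → ∑ (λ x → count ℕ._≟_ x (map (uncurry l) P)) K ≡
      ∑ (λ w′ → ∑ (λ w → count _≟²_ (w , w′) P * count ℕ._≟_ (l w w′) K) (col w′)) (columns col col! col∈)
    by-column l K = trans (∑-count-comm ℕ._≟_ K (map (uncurry l) P))
      (trans (∑-map (λ x → count ℕ._≟_ x K) (uncurry l) P)
             (∑-by-column col col! col∈ (λ p → count ℕ._≟_ (uncurry l p) K)))
    column : ∀ w′ → ∑ (λ w → count _≟²_ (w , w′) P * count ℕ._≟_ (lab w w′) J) (col w′) ≤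
                    ∑ (λ w → count _≟²_ (w , w′) P * count ℕ._≟_ (lab* w w′) top) (col w′)
    column w′ = ℕ.≤-trans
      (column-≤ (proj₁ (proj₂ (proj₂ (proj₂ (ranking w′)))))
        (unique-map (λ v∈ w∈ → inj (Equivalence.to col⇔ v∈) (Equivalence.to col⇔ w∈)) (col! w′)) J!)
      (column-≥ (proj₂ (proj₂ (proj₂ (proj₂ (ranking w′))))) (length J))

-- The Burrows–Wheeler transform and bigrams

iterate-∷ʳ : ∀ {A : Set} (f : A → A) x n → iterate f x (suc n) ≡ iterate f x n ∷ʳ ℕ.iterate f x n
iterate-∷ʳ f x zero    = refl
iterate-∷ʳ f x (suc n) = cong (x ∷_) (iterate-∷ʳ f (f x) n)

-- The orbit closes after n steps, so starting one step later only moves x from the front to the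
-- back.
iterate-↭ : ∀ {A : Set} (f : A → A) x n → ℕ.iterate f x n ≡ x → iterate f (f x) n ↭ iterate f x n
iterate-↭ f x n fⁿx≡x = drop-∷ (↭-trans (↭-reflexive (trans (iterate-∷ʳ f x n)
  (cong (iterate f x n ∷ʳ_) fⁿx≡x))) (↭-sym (∷↭∷ʳ x (iterate f x n))))

tabulate-lookup-cast : ∀ {A B : Set} (f : A → B) xs {n} .(eq : n ≡ length xs) →
                       tabulate (f ∘ lookup xs ∘ cast eq) ≡ map f xs
tabulate-lookup-cast f []       {zero}  eq = refl
tabulate-lookup-cast f (x ∷ xs) {suc n} eq = cong (f x ∷_) (tabulate-lookup-cast f xs (ℕ.suc-injective eq))

lookup-map-cast : ∀ {A B : Set} (f : A → B) xs {n} .(eq : n ≡ length (map f xs)) .(eq′ : n ≡ length xs) i →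
              lookup (map f xs) (cast eq i) ≡ f (lookup xs (cast eq′ i))
lookup-map-cast f (x ∷ xs) {suc n} eq eq′ Fin.zero    = refl
lookup-map-cast f (x ∷ xs) {suc n} eq eq′ (Fin.suc i) = lookup-map-cast f xs (ℕ.suc-injective eq) (ℕ.suc-injective eq′) i

module _ {A : Set} where

  -- The suffix ys makes the induction go through: it collects the symbols already rotated to the
  -- end.
  rotate-++ : ∀ x xs (ys : List A) →
    map List⁺.head (iterate rotate (x ∷ xs ++ ys) (suc (length xs))) ≡ x ∷ xs
    × toList (ℕ.iterate rotate (x ∷ xs ++ ys) (suc (length xs))) ≡ ys ++ x ∷ xs
  rotate-++ x []        []       = refl , refl
  rotate-++ x []        (y ∷ ys) = refl , refl
  rotate-++ x (x′ ∷ xs) ys with rotate-++ x′ xs (ys ∷ʳ x)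
  ... | heads , last rewrite sym (++-assoc xs ys (x ∷ [])) =
    cong (x ∷_) heads , trans last (++-assoc ys (x ∷ []) (x′ ∷ xs))

  toList-injective : ∀ {S T : List⁺ A} → toList S ≡ toList T → S ≡ T
  toList-injective {_ ∷ _} {_ ∷ _} refl = refl

  heads-rotations : ∀ (T : List⁺ A) → map List⁺.head (iterate rotate T (List⁺.length T)) ≡ toList T
  heads-rotations (x ∷ xs) = subst (λ ys → map List⁺.head (iterate rotate (x ∷ ys) (suc (length xs))) ≡ x ∷ xs)
    (++-identityʳ xs) (proj₁ (rotate-++ x xs []))

  rotate-length : ∀ (T : List⁺ A) → ℕ.iterate rotate T (List⁺.length T) ≡ T
  rotate-length (x ∷ xs) = toList-injective (subst
    (λ ys → toList (ℕ.iterate rotate (x ∷ ys) (suc (length xs))) ≡ x ∷ xs)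
    (++-identityʳ xs) (proj₂ (rotate-++ x xs [])))

  last-toList : ∀ (T : List⁺ A) xs {x} → toList T ≡ xs ∷ʳ x → List⁺.last T ≡ x
  last-toList (y ∷ zs) xs eq with List.initLast zs
  ... | []       = ∷ʳ-injectiveʳ [] xs eq
  ... | us ∷ʳ′ u = ∷ʳ-injectiveʳ (y ∷ us) xs eq

  toList-∷ʳ : ∀ xs (x : A) → toList (xs List⁺.∷ʳ x) ≡ xs ∷ʳ x
  toList-∷ʳ []       x = refl
  toList-∷ʳ (y ∷ xs) x = refl

  ends : List⁺ A → A × A
  ends T = List⁺.last T , List⁺.head T

  -- The last symbol of `rotate R` is the head of R, so the ends of successive rotations are pairs
  -- of successive heads.
  ends-rotations : ∀ T n → map ends (iterate rotate (rotate T) n) ≡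
    zip (map List⁺.head (iterate rotate T n)) (map List⁺.head (iterate rotate (rotate T) n))
  ends-rotations T zero    = refl
  ends-rotations T@(x ∷ xs) (suc n) = cong₂ _∷_ (cong (_, List⁺.head (rotate T)) (last-toList (rotate T) xs (toList-∷ʳ xs x))) (ends-rotations (rotate T) n)

module _ {A : Set} {_<_ : Rel A 0ℓ} (isSTO : IsStrictTotalOrder _≡_ _<_) where

  open Strings isSTO
  open IsStrictTotalOrder isSTO using (_<?_; irrefl; compare) renaming (trans to <-trans)

  -- The rotations are first shifted by one step, to begin at `rotate T`; their ends then zip the
  -- heads of the rotations of T, which spell T, with those of `rotate T`.
  bigrams-↭ : ∀ T → map ends (rotations T) ↭ bigrams T
  bigrams-↭ T@(x ∷ xs) = ↭-trans (map-↭ ends (↭-sym (iterate-↭ rotate T (List⁺.length T) (rotate-length T))))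
    (↭-reflexive (trans (ends-rotations T (List⁺.length T)) (cong₂ zip (heads-rotations T)
      (trans (cong (map List⁺.head ∘ iterate rotate (rotate T)) (length-rotate xs)) (heads-rotations (rotate T))))))
    where
    length-rotate : ∀ xs → suc (length xs) ≡ List⁺.length (xs List⁺.∷ʳ x)
    length-rotate []       = refl
    length-rotate (y ∷ xs) = cong suc (sym (trans (length-++ xs) (ℕ.+-comm (length xs) 1)))

  Ascending : List A → Set
  Ascending = AllPairs (λ v w → v < w ⊎ v ≡ w)

  -- Only entries before position i can be smaller than the entry v there, and the entries up to and
  -- including position i are all at most v.
  ascending-inBlock : ∀ {F} → Ascending F → ∀ i → InBlock (toℕ i) (lookup F i) F
  ascending-inBlock {x ∷ F} (x≤F ∷ F↗) Fin.zero =
    ℕ.≤-reflexive (cong length (trans (filter-reject (_<? x) (irrefl refl))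
      (filter-none (_<? x) (All.map (λ { (inj₁ x<y) y<x → irrefl refl (<-trans x<y y<x)
                                       ; (inj₂ refl) y<x → irrefl refl y<x }) x≤F)))) ,
    subst (0 ℕ.<_) (sym (cong length (filter-accept (_≤? x) (inj₂ refl)))) (s≤s z≤n)
  ascending-inBlock {x ∷ F} (x≤F ∷ F↗) (Fin.suc i) with ascending-inBlock F↗ i
  ... | lower , upper =
    ℕ.≤-trans (filter-∷-≤ (_<? v)) (s≤s lower) ,
    subst (suc (toℕ i) ℕ.<_) (sym (cong length (filter-accept (_≤? v) (All.lookup x≤F (∈-lookup i))))) (s≤s upper)
    where
    v = lookup F i
    filter-∷-≤ : ∀ {P : A → Set} (P? : ∀ x → Relation.Nullary.Dec (P x)) →
                 length (filter P? (x ∷ F)) ℕ.≤ suc (length (filter P? F))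
    filter-∷-≤ P? with P? x
    ... | yes _ = ℕ.≤-refl
    ... | no _  = ℕ.n≤1+n _

  InBlock-↭ : ∀ {i w xs ys} → xs ↭ ys → InBlock i w xs → InBlock i w ys
  InBlock-↭ {i} {w} xs↭ys (lower , upper) =
    subst (ℕ._≤ i) (↭-length (filter-↭ (_<? w) xs↭ys)) lower ,
    subst (i ℕ.<_) (↭-length (filter-↭ (_≤? w) xs↭ys)) upper

  heads-ascending : ∀ T → Ascending (map List⁺.head (sort lexOrder (rotations T)))
  heads-ascending T = AllPairs.map⁺ (AllPairs.map head-≤
    (Linked⇒AllPairs (λ {R} {S} {U} → DecTotalOrder.trans lexOrder {R} {S} {U}) (sort-↗ lexOrder (rotations T))))
    where
    head-≤ : ∀ {S U} → DecTotalOrder._≤_ lexOrder S U → List⁺.head S < List⁺.head U ⊎ List⁺.head S ≡ List⁺.head U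
    head-≤ {_ ∷ _} {_ ∷ _} (this x<y)   = inj₁ x<y
    head-≤ {_ ∷ _} {_ ∷ _} (next x≡y _) = inj₂ x≡y

  heads-↭ : ∀ T → map List⁺.head (sort lexOrder (rotations T)) ↭ toList T
  heads-↭ T = ↭-trans (map-↭ List⁺.head (sort-↭ lexOrder (rotations T))) (↭-reflexive (heads-rotations T))

  length-sorted : ∀ T → List⁺.length T ≡ length (sort lexOrder (rotations T))
  length-sorted T = sym (trans (↭-length (sort-↭ lexOrder (rotations T))) (length-iterate rotate T (List⁺.length T)))

  -- For the i-th sorted rotation, the BWT symbol is its last symbol and the block symbol is its
  -- head, so the label read at i is that of the pair `ends`. These pairs are the bigrams up to
  -- order.
  labelled-bwt-↭ : ∀ {B : Set} (f : A → A → B) T →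
    tabulate {n = List⁺.length T} (λ i → f (lookup (bwt T) (cast (sym (length-bwt T)) i))
                                          (proj₁ (blockSymbol T (toℕ<n i)))) ↭
    map (uncurry f) (bigrams T)
  labelled-bwt-↭ f T = ↭-trans
    (↭-reflexive (trans (tabulate-cong pointwise) (trans (tabulate-lookup-cast (uncurry f ∘ ends) rs (length-sorted T)) (map-∘ rs))))
    (map-↭ (uncurry f) (↭-trans (map-↭ ends (sort-↭ lexOrder (rotations T))) (bigrams-↭ T)))
    where
    rs = sort lexOrder (rotations T)
    block : ∀ i → proj₁ (blockSymbol T (toℕ<n i)) ≡ List⁺.head (lookup rs (cast (length-sorted T) i))
    -- The block symbol is unique, and the head of the i-th sorted rotation qualifies too: the
    -- sorted heads ascend and are a permutation of T.
    block i = proj₂ (proj₂ (blockSymbol T (toℕ<n i))) (InBlock-↭ (heads-↭ T)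
      (subst₂ (λ k w → InBlock k w (map List⁺.head rs)) (toℕ-cast eq i)
        (lookup-map-cast List⁺.head rs eq (length-sorted T) i)
        (ascending-inBlock (heads-ascending T) (cast eq i))))
      where
      eq : List⁺.length T ≡ length (map List⁺.head rs)
      eq = trans (length-sorted T) (sym (length-map List⁺.head rs))
    pointwise : ∀ i → f (lookup (bwt T) (cast (sym (length-bwt T)) i)) (proj₁ (blockSymbol T (toℕ<n i))) ≡
                      uncurry f (ends (lookup rs (cast (length-sorted T) i)))
    pointwise i = cong₂ f (lookup-map-cast List⁺.last rs (sym (length-bwt T)) (length-sorted T) i) (block i)

-- From label counts to entropy

module _ (_≟_ : DecidableEquality A) where

  -- Elements of R absent from S contribute 0^0 = 1, so R may be a fixed range of labels.
  product-multiplicities : ∀ {R S} → Unique R → All (_∈ R) S →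
                           selfPowers (map (λ x → count _≟_ x S) R) ≡ product (multiplicities _≟_ S)
  product-multiplicities {R} {S} R! S⊆R = trans (cong product (sym (map-∘ R)))
    (⨁-count ℕ.*-1-commutativeMonoid _≟_ (λ x → count _≟_ x S) (λ k x → count _≟_ x S ^ k)
      (λ _ → refl) (λ _ _ → refl) R! S⊆R)

  product-multiplicities-↭ : ∀ {S S′} → S ↭ S′ → product (multiplicities _≟_ S) ≡ product (multiplicities _≟_ S′)
  product-multiplicities-↭ {S} {S′} S↭S′ = trans
    (cong product (map-cong (λ s → ↭-length (filter-↭ (s ≟_) S↭S′)) S))
    (product-↭ (map-↭ (λ s → count _≟_ s S′) S↭S′))

product-multiplicities-mono : ∀ {S S′ : List ℕ} n → length S ≡ length S′ →
  All (_∈ applyUpTo suc n) S → All (_∈ applyUpTo suc n) S′ →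
  (∀ {J} → Unique J → ∑ (λ x → count _≟_ x S) J ≤ ∑ (λ x → count _≟_ x S′) (applyUpTo suc (length J))) →
  product (multiplicities _≟_ S) ≤ product (multiplicities _≟_ S′)
product-multiplicities-mono {S} {S′} n len≡ S⊆ S′⊆ dominated = subst₂ _≤_
  (product-multiplicities _≟_ R! S⊆) (product-multiplicities _≟_ R! S′⊆)
  (selfPowers-mono {length S} (bounded S ℕ.≤-refl) (bounded S′ (ℕ.≤-reflexive (sym len≡)))
    (excess-mono dominated n))
  where
  R! = Unique.applyUpTo⁺₁ suc n λ i<j _ → ℕ.<⇒≢ i<j ∘ ℕ.suc-injective
  bounded : ∀ V → length V ≤ length S → All (_≤ length S) (map (λ x → count _≟_ x V) (applyUpTo suc n))
  bounded V V≤S = All.map⁺ (All.universal (λ x → ℕ.≤-trans (count-≤ _≟_ V x) V≤S) _)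

theorem3 : (G : RoadNetwork) → let open Trajectories G in
    (Ts : List⁺ NCT) (φ* : RML (trajectoryString Ts)) → IsBigramOrdered φ* →
    (φ : RML (trajectoryString Ts)) →
    H₀ _≟_ (labeledBWT (trajectoryString Ts) φ*) ≤ℝ H₀ _≟_ (labeledBWT (trajectoryString Ts) φ)
theorem3 G Ts φ* ordered φ = H₀-antitone _≟_ {labeledBWT T φ} {labeledBWT T φ*}
  (trans (length-labels φ) (sym (length-labels φ*)))
  -- Multiplicities ignore order, so the labels may be listed along the bigrams of T, where
  -- `ranking-dominates` applies.
  (subst₂ _≤_ (product-multiplicities-↭ _≟_ (↭-sym (bwt-↭ φ))) (product-multiplicities-↭ _≟_ (↭-sym (bwt-↭ φ*)))
    (product-multiplicities-mono σ (trans (length-map _ (bigrams T)) (sym (length-map _ (bigrams T))))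
      (labels⊆ φ) (labels⊆ φ*)
      (ranking-dominates (IsStrictTotalOrder._≟_ <-isStrictTotalOrder) (bigrams T) ordered (label-inj φ))))
  where
  open Trajectories G
  T = trajectoryString Ts
  bwt-↭ : ∀ ψ → labeledBWT T ψ ↭ map (uncurry (label ψ)) (bigrams T)
  bwt-↭ ψ = labelled-bwt-↭ <-isStrictTotalOrder (label ψ) T
  length-labels : ∀ ψ → length (labeledBWT T ψ) ≡ length (bigrams T)
  length-labels ψ = trans (↭-length (bwt-↭ ψ)) (length-map _ (bigrams T))
  range : ∀ {l n} → 1 ≤ l × l ≤ n → l ∈ applyUpTo suc n
  range {suc l} (_ , l<n) = ∈-applyUpTo⁺ suc l<n
  labels⊆ : ∀ (ψ : RML T) → All (_∈ applyUpTo suc σ) (map (uncurry (label ψ)) (bigrams T))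
  labels⊆ ψ = All.map⁺ (All.tabulate λ p∈ → range (label-range ψ p∈))
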